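{- Let $\omega_0=\log_2 7$. In the machine model, and for the algorithm CAPS and its admissible parameters $n,P,M$, described in the context, CAPS applied to $n\times n$ matrices on $P$ processors with local memory size $M$ has computational cost $$\Theta\left(\frac{n^{\omega_0}}{P}\right),$$ bandwidth cost $$\Theta\left(\max\left\{\frac{n^{\omega_0}}{PM^{\omega_0/2-1}},\ \frac{n^2}{P^{2/\omega_0}}\right\}\right),$$ and latency cost $$\Theta\left(\max\left\{\frac{n^{\omega_0}}{PM^{\omega_0/2}}\log P,\ \log P\right\}\right),$$ where the constants implied by $\Theta$ are absolute (uniform over all admissible $n,P,M$).
   Context: Machine model. There are $P$ processors, each with a local memory of $M$ words, connected by a network with a link between every pair of processors (no contention). Processors communicate by messages; a message consists of some number $w$ of words. A processor can send/receive only one message to/from one processor at a time and cannot overlap communication with computation. Costs are counted along the critical path of the execution (two messages communicated simultaneously between separate pairs of processors count once, as do two floating point operations performed in parallel on different processors): the computational cost is the number of floating point operations, the bandwidth cost is the number of words communicated, and the latency cost is the number of messages. Strassen's algorithm. One step of Strassen's algorithm splits $A$, $B$, $C$ (with $C=AB$) into $2\times 2$ arrays of equal-size blocks, forms 7 fixed linear combinations $S_1,\dots,S_7$ of the blocks of $A$ and 7 fixed linear combinations $T_1,\dots,T_7$ of the blocks of $B$, computes the 7 products $Q_i=S_iT_i$, and forms the blocks of $C$ as fixed linear combinations of the $Q_i$ (18 block additions/subtractions in total). Admissible parameters for CAPS. $P=7^k$ with $k\ge 1$ an integer; $3n^2/P\le M/3$; and, setting $$\ell=\max\left\{0,\left\lceil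 \log_2\frac{4n}{P^{1/\omega_0}M^{1/2}}\right\rceil\right\},\qquad s=\ell+k,$$ $n$ is a multiple of $2^s7^{\lceil k/2\rceil}$. Data layout. Each of $A$, $B$, $C$ is distributed (one copy) over the $P$ processors so that, at each of the $s$ recursion levels, the four quadrants of the matrix under consideration are distributed identically and every such submatrix is distributed equally among the processors involved. An example is the block-cyclic layout on a $7^{\lfloor k/2\rfloor}\times 7^{\lceil k/2\rceil}$ processor grid with block size $\frac{n}{2^s7^{\lfloor k/2\rfloor}}\times\frac{n}{2^s7^{\lceil k/2\rceil}}$. The input is assumed to be initially in this layout. Processors are numbered in base 7 with $k$ digits. Algorithm CAPS (Communication-Avoiding Parallel Strassen). It performs $\ell$ DFS steps, then $k$ BFS steps, then local multiplication, as follows. - DFS step (on a problem of size $m$ with $p$ processors): for $i=1,\dots,7$ in sequence, all $p$ processors locally compute their portions of $S_i,T_i$ (no communication is needed, by the layout property), all $p$ processors recursively compute $Q_i=S_iT_i$ (a problem of size $m/2$ on $p$ processors), and the contribution of $Q_i$ to $C$ is added locally; the space for $S_i,T_i,Q_i$ is then reused. - BFS step (on a problem of size $m$ with $p$ processors): each processor locally computes its portions of all $S_1,\dots,S_7,T_1,\dots,T_7$. Within each group of seven processors whose base-7 numbers differ only in one given digit (a different digit for each BFS level), an all-to-all exchange is performed, after which the processor of the group with that digit corresponding to $i$ holds all of the group's portions of $S_i$ and $T_i$. Thus the seven products $Q_i=S_iT_i$ are computed recursively and in parallel on seven disjoint sets of $p/7$ processors (problems of size $m/2$ on $p/7$ processors).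 Then the $Q_i$ are redistributed back by the reverse all-to-all within each group, and $C$ is computed locally from the $Q_i$. For each of the three families $(S_i)$, $(T_i)$, $(Q_i)$, each processor sends 6 messages and receives 6 messages, each of $m^2/(4p)$ words. - After the $k$ BFS steps each subproblem lies on one processor and is solved locally with the sequential Strassen algorithm, using $c_s m^{\omega_0}-6m^2=\Theta(m^{\omega_0})$ operations on size-$m$ matrices ($c_s$ the constant of the sequential algorithm), with no communication and (by assumption) no extra memory. -}

module Defs where

open import Level using (Level) renaming (suc to lsuc; _⊔_ to _⊔ˡ_)
open import Algebra.Apartness.Bundles using (HeytingField; HeytingCommutativeRing)
open import Algebra.Bundles using (CommutativeRing)
open import Algebra.Core using (Op₂)
import Algebra.Properties.Monoid.Mult as Mult
import Algebra.Properties.Ring as RingProperties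
open import Data.Bool.Base using (not; if_then_else_; _∧_)
open import Data.Fin.Base using (Fin; zero; suc; toℕ; combine)
import Data.Fin.Properties as Fin
open import Data.Integer.Base as ℤ using (ℤ; +_; -[1+_]; 0ℤ; 1ℤ; -1ℤ)
import Data.Integer.Properties as ℤ
open import Data.List.Base as List using (List; []; _∷_; _++_; allFin; concatMap; foldl; foldr)
open import Data.List.Relation.Binary.Permutation.Propositional using (_↭_)
open import Data.Nat.Base as ℕ using (ℕ; zero; suc; NonZero; ⌈_/2⌉; z≤n; s≤s)
open import Data.Nat.Divisibility using (_∣_)
open import Data.Nat.DivMod using (_/_)
import Data.Nat.Properties as ℕ
open import Data.Nat.ListAction using (sum)
open import Data.Product.Base using (Σ-syntax; ∃-syntax; _×_; _,_; proj₁; proj₂)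
open import Data.Sum.Base using (_⊎_; inj₁; inj₂)
open import Data.Vec.Base as Vec using (Vec; []; _∷_; lookup)
import Data.Vec.Properties as Vec
open import Function.Base using (id)
open import Function.Bundles using (_⇔_; Equivalence)
open import Relation.Binary.Core using (Rel)
open import Relation.Binary.Definitions using (DecidableEquality)
open import Relation.Binary.Lattice.Definitions using (Supremum)
open import Relation.Binary.PropositionalEquality using (_≡_)
import Relation.Binary.PropositionalEquality as ≡
open import Relation.Binary.Structures using (IsStrictPartialOrder)
open import Relation.Nullary.Decidable using (from-yes)
open import Relation.Nullary using (¬_; does; ¬?; contradiction)

------------------------------------------------------------------------
-- Real numbers

record OrderedField (c ℓ₁ ℓ₂ ℓ₃ : Level) : Set (lsuc (c ⊔ˡ ℓ₁ ⊔ˡ ℓ₂ ⊔ˡ ℓ₃)) where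
  field
    heytingField : HeytingField c ℓ₁ ℓ₂

  open HeytingField heytingField public
    hiding (isHeytingField)

  open HeytingCommutativeRing heytingCommutativeRing public
    using (commutativeRing)

  infix  4 _<_ _≤_
  infixl 6 _⊔_

  field
    _<_                  : Rel Carrier ℓ₃
    isStrictPartialOrder : IsStrictPartialOrder _≈_ _<_
    #⇔<⊎>                : ∀ {x y} → x # y ⇔ (x < y ⊎ y < x)
    0<1                  : 0# < 1#
    +-monoˡ-<            : ∀ {x y} z → x < y → x + z < y + z
    *-pos                : ∀ {x y} → 0# < x → 0# < y → 0# < x * y

  _≤_ : Rel Carrier ℓ₃
  x ≤ y = ¬ (y < x)

  field
    _⊔_                  : Op₂ Carrier
    ⊔-supremum           : Supremum _≤_ _⊔_

  open IsStrictPartialOrder isStrictPartialOrder public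
    using (<-respʳ-≈; <-respˡ-≈)
    renaming (irrefl to <-irrefl; trans to <-trans)

  fromℕ : ℕ → Carrier
  fromℕ n = n ·ₘ 1#
    where open Mult (CommutativeRing.+-monoid commutativeRing) renaming (_×_ to _·ₘ_)

  fromℤ : ℤ → Carrier
  fromℤ (+ n)    = fromℕ n
  fromℤ -[1+ n ] = - fromℕ (suc n)

  Cauchy : (ℕ → Carrier) → Set (c ⊔ˡ ℓ₃)
  Cauchy u = ∀ ε → 0# < ε → ∃[ N ] (∀ i j → N ℕ.≤ i → N ℕ.≤ j → u i < u j + ε)

  _⟶_ : (ℕ → Carrier) → Carrier → Set (c ⊔ˡ ℓ₃)
  u ⟶ x = ∀ ε → 0# < ε → ∃[ N ] (∀ i → N ℕ.≤ i → u i < x + ε × x < u i + ε)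

  ℝ⁺ : Set (c ⊔ˡ ℓ₃)
  ℝ⁺ = Σ[ x ∈ Carrier ] 0# < x

  infix 4 _≈⁺_

  _≈⁺_ : Rel ℝ⁺ ℓ₁
  (x , _) ≈⁺ (y , _) = x ≈ y

  n<1+n : ∀ x → x < 1# + x
  n<1+n x = <-respˡ-≈ (+-identityˡ x) (+-monoˡ-< x 0<1)

  fromℕ-mono-< : ∀ {m n} → m ℕ.< n → fromℕ m < fromℕ n
  fromℕ-mono-< {m} {suc n} (s≤s m≤n) with ℕ.m≤n⇒m<n∨m≡n m≤n
  ... | inj₁ m<n    = <-trans (fromℕ-mono-< {m} {n} m<n) (n<1+n (fromℕ n))
  ... | inj₂ ≡.refl = n<1+n (fromℕ n)

  ι : (n : ℕ) .{{_ : NonZero n}} → ℝ⁺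
  ι (suc n) = fromℕ (suc n) , fromℕ-mono-< {0} {suc n} (s≤s z≤n)

  infixl 7 _*⁺_ _/⁺_ _÷_

  _*⁺_ : ℝ⁺ → ℝ⁺ → ℝ⁺
  (x , 0<x) *⁺ (y , 0<y) = x * y , *-pos 0<x 0<y

  inverse : ((x , _) : ℝ⁺) → Σ[ y ∈ Carrier ] x * y ≈ 1#
  inverse (x , 0<x) =
    let y , _ , [x-0]*y≈1 = #⇒invertible (Equivalence.from #⇔<⊎> (inj₂ 0<x))
    in  y , trans (*-congʳ (sym (trans (+-congˡ -0#≈0#) (+-identityʳ x)))) [x-0]*y≈1
    where
    open RingProperties (CommutativeRing.ring commutativeRing) using (-0#≈0#)

  _⁻¹ : ℝ⁺ → Carrier
  x ⁻¹ = proj₁ (inverse x)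

  ⁻¹-pos : ∀ x → 0# < x ⁻¹
  ⁻¹-pos x⁺@(x , 0<x) with Equivalence.to #⇔<⊎> (invertible⇒# y-0-invertible)
    where
    open RingProperties (CommutativeRing.ring commutativeRing) using (-0#≈0#)
    y   = x⁺ ⁻¹
    y-0≈y : y - 0# ≈ y
    y-0≈y = trans (+-congˡ -0#≈0#) (+-identityʳ y)
    y-0-invertible =
      x , trans (*-congˡ y-0≈y) (proj₂ (inverse x⁺))
        , trans (*-congʳ y-0≈y) (trans (*-comm y x) (proj₂ (inverse x⁺)))
  ... | inj₂ 0<y = 0<y
  ... | inj₁ y<0 = contradiction (<-trans 0<1 1<0) (<-irrefl refl)
    where
    open RingProperties (CommutativeRing.ring commutativeRing) using (-‿distribʳ-*)
    y = x⁺ ⁻¹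
    0<-y : 0# < - y
    0<-y = <-respˡ-≈ (-‿inverseʳ y) (<-respʳ-≈ (+-identityˡ (- y)) (+-monoˡ-< (- y) y<0))
    0<-1 : 0# < - 1#
    0<-1 = <-respʳ-≈ (trans (sym (-‿distribʳ-* x y)) (-‿cong (proj₂ (inverse x⁺))))
                     (*-pos 0<x 0<-y)
    1<0 : 1# < 0#
    1<0 = <-respˡ-≈ (+-identityˡ 1#) (<-respʳ-≈ (-‿inverseˡ 1#) (+-monoˡ-< 1# 0<-1))

  _÷_ : Carrier → ℝ⁺ → Carrier
  x ÷ y = x * y ⁻¹

  _/⁺_ : ℝ⁺ → ℝ⁺ → ℝ⁺
  x /⁺ y = x *⁺ (y ⁻¹ , ⁻¹-pos y)

  IsCeiling : Carrier → ℤ → Set ℓ₃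
  IsCeiling x z = x ≤ fromℤ z × fromℤ z - 1# < x

  -- f = Θ(g), with constants uniform over the whole index type.
  Θ : ∀ {i} {I : Set i} → (I → Carrier) → (I → Carrier) → Set (c ⊔ˡ ℓ₃ ⊔ˡ i)
  Θ f g = Σ[ (a , _) ∈ ℝ⁺ ] Σ[ (b , _) ∈ ℝ⁺ ] ∀ i → a * g i ≤ f i × f i ≤ b * g i

-- The reals: an Archimedean, Cauchy complete ordered field.  All axioms are
-- constructively valid; in particular the order is not assumed decidable.  Real
-- powers and the binary logarithm are part of the structure rather than defined;
-- the laws given determine both of them uniquely.

record RealNumbers (c ℓ₁ ℓ₂ ℓ₃ : Level) : Set (lsuc (c ⊔ˡ ℓ₁ ⊔ˡ ℓ₂ ⊔ˡ ℓ₃)) where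
  field
    orderedField : OrderedField c ℓ₁ ℓ₂ ℓ₃

  open OrderedField orderedField public renaming (Carrier to ℝ)

  infixr 8 _^_

  field
    archimedean    : ∀ x → ∃[ n ] x < fromℕ n
    complete       : ∀ u → Cauchy u → ∃[ x ] u ⟶ x
    _^_            : ℝ⁺ → ℝ → ℝ⁺
    ^-cong         : ∀ {x x′ y y′} → x ≈⁺ x′ → y ≈ y′ → x ^ y ≈⁺ x′ ^ y′
    ^-identityʳ    : ∀ x → x ^ 1# ≈⁺ x
    ^-distribˡ-+-* : ∀ x y z → x ^ (y + z) ≈⁺ (x ^ y) *⁺ (x ^ z)
    ^-*-assoc      : ∀ x y z → (x ^ y) ^ z ≈⁺ x ^ (y * z)
    ^-distribʳ-*   : ∀ x y z → (x *⁺ y) ^ z ≈⁺ (x ^ z) *⁺ (y ^ z)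
    ^-monoʳ-<      : ∀ x {y z} → 1# < proj₁ x → y < z → proj₁ (x ^ y) < proj₁ (x ^ z)
    log₂           : ℝ⁺ → ℝ
    log₂-cong      : ∀ {x y} → x ≈⁺ y → log₂ x ≈ log₂ y
    log₂-mono-<    : ∀ {x y} → proj₁ x < proj₁ y → log₂ x < log₂ y
    2^log₂         : ∀ x → ι 2 ^ log₂ x ≈⁺ x
    log₂-2^        : ∀ y → log₂ (ι 2 ^ y) ≈ y

  0<log₂7 : 0# < log₂ (ι 7)
  0<log₂7 = <-trans 0<1 (<-respˡ-≈ log₂2≈1 (log₂-mono-< {ι 2} {ι 7} (fromℕ-mono-< {2} {7} 2<7)))
    where
    2<7 : 2 ℕ.< 7
    2<7 = s≤s (s≤s (s≤s z≤n))
    log₂2≈1 : log₂ (ι 2) ≈ 1#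
    log₂2≈1 = trans (sym (log₂-cong (^-identityʳ (ι 2)))) (log₂-2^ 1#)

  ω₀ : ℝ⁺
  ω₀ = log₂ (ι 7) , 0<log₂7

------------------------------------------------------------------------
-- Executions and their critical path

-- An execution is a list of events, listed in some order compatible with
-- causality.  Two events depend on each other only if they involve a common
-- processor, so events of disjoint sets of processors run in parallel wherever
-- they occur in the list.  A message occupies its sender and its receiver
-- exclusively; this is the rule that a processor handles one message at a time and
-- does not overlap communication with computation.

module Machine {c ℓ₁ ℓ₂ ℓ₃} (𝓡 : RealNumbers c ℓ₁ ℓ₂ ℓ₃)
               {Proc : Set} (_≟_ : DecidableEquality Proc) where
  open RealNumbers 𝓡

  data Event : Set c where
    compute : (p : Proc) (flops : ℝ) → Event
    message : (from to : Proc) (words : ℕ) → Event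

  Clock : Set c
  Clock = Proc → ℝ

  _[_≔_] : Clock → Proc → ℝ → Clock
  (t [ p ≔ x ]) q = if does (p ≟ q) then x else t q

  module _ (weight : Event → ℝ) where

    -- After a run from the zero clock, t p is the largest total weight of a chain
    -- of successively dependent events whose last one involves p.
    tick : Clock → Event → Clock
    tick t e@(compute p _)   = t [ p ≔ t p + weight e ]
    tick t e@(message p q _) = t [ p ≔ x ] [ q ≔ x ]
      where x = (t p ⊔ t q) + weight e

    run : Clock → List Event → Clock
    run = foldl tick

    criticalPath : List Proc → List Event → ℝ
    criticalPath ps es = foldr (λ p x → run (λ _ → 0#) es p ⊔ x) 0# ps

  flops words messages : Event → ℝ
  flops (compute _ x)      = x
  flops (message _ _ _)    = 0#
  words (compute _ _)      = 0#
  words (message _ _ w)    = fromℕ w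
  messages (compute _ _)   = 0#
  messages (message _ _ _) = 1#

------------------------------------------------------------------------
-- One step of Strassen's algorithm

-- Blocks are listed in the order 11, 12, 21, 22.  Row i of leftS (rightT) holds the
-- coefficients of Sᵢ (Tᵢ) in terms of the blocks of A (B); row b of outC holds those
-- of block b of C in terms of Q₁, …, Q₇.

leftS rightT : Vec (Vec ℤ 4) 7
leftS  = (1ℤ  ∷ 0ℤ ∷ 0ℤ ∷ 1ℤ  ∷ [])
       ∷ (0ℤ  ∷ 0ℤ ∷ 1ℤ ∷ 1ℤ  ∷ [])
       ∷ (1ℤ  ∷ 0ℤ ∷ 0ℤ ∷ 0ℤ  ∷ [])
       ∷ (0ℤ  ∷ 0ℤ ∷ 0ℤ ∷ 1ℤ  ∷ [])
       ∷ (1ℤ  ∷ 1ℤ ∷ 0ℤ ∷ 0ℤ  ∷ [])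
       ∷ (-1ℤ ∷ 0ℤ ∷ 1ℤ ∷ 0ℤ  ∷ [])
       ∷ (0ℤ  ∷ 1ℤ ∷ 0ℤ ∷ -1ℤ ∷ [])
       ∷ []
rightT = (1ℤ  ∷ 0ℤ ∷ 0ℤ ∷ 1ℤ  ∷ [])
       ∷ (1ℤ  ∷ 0ℤ ∷ 0ℤ ∷ 0ℤ  ∷ [])
       ∷ (0ℤ  ∷ 1ℤ ∷ 0ℤ ∷ -1ℤ ∷ [])
       ∷ (-1ℤ ∷ 0ℤ ∷ 1ℤ ∷ 0ℤ  ∷ [])
       ∷ (0ℤ  ∷ 0ℤ ∷ 0ℤ ∷ 1ℤ  ∷ [])
       ∷ (1ℤ  ∷ 1ℤ ∷ 0ℤ ∷ 0ℤ  ∷ [])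
       ∷ (0ℤ  ∷ 0ℤ ∷ 1ℤ ∷ 1ℤ  ∷ [])
       ∷ []

outC : Vec (Vec ℤ 7) 4
outC = (1ℤ ∷ 0ℤ  ∷ 0ℤ ∷ 1ℤ ∷ -1ℤ ∷ 0ℤ ∷ 1ℤ ∷ [])
     ∷ (0ℤ ∷ 0ℤ  ∷ 1ℤ ∷ 0ℤ ∷ 1ℤ  ∷ 0ℤ ∷ 0ℤ ∷ [])
     ∷ (0ℤ ∷ 1ℤ  ∷ 0ℤ ∷ 1ℤ ∷ 0ℤ  ∷ 0ℤ ∷ 0ℤ ∷ [])
     ∷ (1ℤ ∷ -1ℤ ∷ 1ℤ ∷ 0ℤ ∷ 0ℤ  ∷ 1ℤ ∷ 0ℤ ∷ [])
     ∷ []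

-- The coefficient of A(i , l) B(l′ , j′) in block (r , j) of C.
coefficient : (i l l′ j′ r j : Fin 2) → ℤ
coefficient i l l′ j′ r j = foldr ℤ._+_ 0ℤ (List.map
  (λ q → lookup (lookup outC (combine r j)) q
         ℤ.* lookup (lookup leftS q) (combine i l)
         ℤ.* lookup (lookup rightT q) (combine l′ j′))
  (allFin 7))

strassen-correct : ∀ i l l′ j′ r j → coefficient i l l′ j′ r j
  ≡ (if does (r Fin.≟ i) ∧ does (l Fin.≟ l′) ∧ does (j Fin.≟ j′) then 1ℤ else 0ℤ)
strassen-correct = from-yes
  (Fin.all? λ i → Fin.all? λ l → Fin.all? λ l′ → Fin.all? λ j′ → Fin.all? λ r → Fin.all? λ j →
    coefficient i l l′ j′ r j
      ℤ.≟ (if does (r Fin.≟ i) ∧ does (l Fin.≟ l′) ∧ does (j Fin.≟ j′) then 1ℤ else 0ℤ))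

terms : ∀ {n} → Vec ℤ n → ℕ
terms = Vec.countᵇ (λ z → not (does (z ℤ.≟ 0ℤ)))

-- Block additions and subtractions needed to form a linear combination.
additions : ∀ {n} → Vec ℤ n → ℕ
additions v = terms v ℕ.∸ 1

additionsS additionsT : Fin 7 → ℕ
additionsS i = additions (lookup leftS i)
additionsT i = additions (lookup rightT i)

additionsC : ℕ
additionsC = Vec.sum (Vec.map additions outC)

-- Block additions needed to add the contribution of Qᵢ when Q₁, …, Q₇ arrive in
-- this order: the first contribution to a block of C is only a copy.
accumulations : Fin 7 → ℕ
accumulations i = Vec.sum (Vec.map row outC)
  where
  row : Vec ℤ 7 → ℕ
  row v = if does (lookup v i ℤ.≟ 0ℤ) then 0
          else (1 ℕ.⊓ sum (List.map nonzero (List.filterᵇ (λ j → toℕ j ℕ.<ᵇ toℕ i) (allFin 7))))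
    where
    nonzero : Fin 7 → ℕ
    nonzero j = if does (lookup v j ℤ.≟ 0ℤ) then 0 else 1

total : (Fin 7 → ℕ) → ℕ
total f = sum (List.map f (allFin 7))

additions≡18 : total additionsS ℕ.+ total additionsT ℕ.+ additionsC ≡ 18
additions≡18 = ≡.refl

accumulations≡additionsC : total accumulations ≡ additionsC
accumulations≡additionsC = ≡.refl

------------------------------------------------------------------------
-- Communication-avoiding parallel Strassen

-- The order in which the 42 messages of an all-to-all exchange among seven
-- processors are sent; an entry (a , b) stands for a message from a to b.

distinctPairs : List (Fin 7 × Fin 7)
distinctPairs =
  List.filter (λ (a , b) → ¬? (a Fin.≟ b)) (List.cartesianProduct (allFin 7) (allFin 7))

Schedule : Set
Schedule = Σ[ σ ∈ List (Fin 7 × Fin 7) ] σ ↭ distinctPairs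

-- Processors are numbered in base 7 with k digits.
Processor : ℕ → Set
Processor = Vec (Fin 7)

allProcessors : ∀ k → List (Processor k)
allProcessors zero    = [] ∷ []
allProcessors (suc k) = concatMap (λ d → List.map (d ∷_) (allProcessors k)) (allFin 7)

module CAPS {c ℓ₁ ℓ₂ ℓ₃} (𝓡 : RealNumbers c ℓ₁ ℓ₂ ℓ₃) where
  open RealNumbers 𝓡

  -- m ^ω₀ is m to the power ω₀, with 0 ^ω₀ = 0.
  _^ω₀ : ℕ → ℝ
  zero      ^ω₀ = 0#
  m@(suc _) ^ω₀ = proj₁ (ι m ^ proj₁ ω₀)

  -- Operation count of the sequential algorithm on matrices of size m.
  sequentialFlops : ℝ → ℕ → ℝ
  sequentialFlops cₛ m = cₛ * m ^ω₀ - fromℕ (6 ℕ.* (m ℕ.* m))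

  module Algorithm (cₛ : ℝ) (schedule : Schedule) (k : ℕ) where
    open Machine 𝓡 {Processor k} (Vec.≡-dec Fin._≟_) public

    -- A (sub)problem on 7 ^ j processors is run by the processors in the image of
    -- an embedding e : Processor j → Processor k.

    -- A processor's portion, in words, of one of the four blocks of an m × m matrix
    -- spread evenly over 7 ^ j processors.  The division is exact for admissible
    -- parameters.
    share : ℕ → ℕ → ℕ
    share j m = _/_ (m ℕ.* m) (4 ℕ.* 7 ℕ.^ j) {{ℕ.m*n≢0 4 (7 ℕ.^ j) {{_}} {{ℕ.m^n≢0 7 j}}}}

    addBlocks : ∀ {j} → (Processor j → Processor k) → ℕ → ℕ → List Event
    addBlocks {j} e m a =
      List.map (λ p → compute (e p) (fromℕ (a ℕ.* share j m))) (allProcessors j)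

    exchange : ∀ {j} → (Processor (suc j) → Processor k) → ℕ → List Event
    exchange {j} e m =
      concatMap (λ p → List.map (λ (a , b) → message (e (a ∷ p)) (e (b ∷ p)) (share (suc j) m))
                                (proj₁ schedule))
                (allProcessors j)

    bfs : ∀ {j} → (Processor j → Processor k) → ℕ → List Event
    bfs {zero}  e m = compute (e []) (sequentialFlops cₛ m) ∷ []
    bfs {suc j} e m =
         addBlocks e m (total additionsS ℕ.+ total additionsT)
      ++ exchange e m                                        -- Sᵢ
      ++ exchange e m                                        -- Tᵢ
      ++ concatMap (λ i → bfs (λ p → e (i ∷ p)) (m / 2)) (allFin 7)
      ++ exchange e m                                        -- Qᵢ
      ++ addBlocks e m additionsC

    dfs : ℕ → ℕ → List Event
    dfs zero    m = bfs id m
    dfs (suc ℓ) m =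
      concatMap (λ i → addBlocks id m (additionsS i ℕ.+ additionsT i)
                    ++ dfs ℓ (m / 2)
                    ++ addBlocks id m (accumulations i))
                (allFin 7)

  -- ⌈log⌉ is the ceiling occurring in the definition of ℓ.
  record Admissible : Set ℓ₃ where
    field
      n P M k ℓ s : ℕ
      {{n≢0}}     : NonZero n
      {{P≢0}}     : NonZero P
      {{M≢0}}     : NonZero M
      P≡7^k       : P ≡ 7 ℕ.^ k
      1≤k         : 1 ℕ.≤ k
      3n²/P≤M/3   : fromℕ (3 ℕ.* (n ℕ.* n)) ÷ ι P ≤ fromℕ M ÷ ι 3
      ⌈log⌉       : ℤ
      isCeiling   : IsCeiling
        (log₂ ((ι 4 *⁺ ι n) /⁺ ((ι P ^ (1# ÷ ω₀)) *⁺ (ι M ^ (1# ÷ ι 2))))) ⌈log⌉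
      ℓ≡max       : + ℓ ≡ 0ℤ ℤ.⊔ ⌈log⌉
      s≡ℓ+k       : s ≡ ℓ ℕ.+ k
      divisible   : 2 ℕ.^ s ℕ.* 7 ℕ.^ ⌈ k /2⌉ ∣ n

  module Costs (cₛ : ℝ) (schedule : Schedule) (π : Admissible) where
    open Admissible π
    open Algorithm cₛ schedule k

    execution : List Event
    execution = dfs ℓ n

    computationalCost bandwidthCost latencyCost : ℝ
    computationalCost = criticalPath flops    (allProcessors k) execution
    bandwidthCost     = criticalPath words    (allProcessors k) execution
    latencyCost       = criticalPath messages (allProcessors k) execution

{-# OPTIONS --safe #-}
-- Write n = 2^ℓ 2^k b; the divisibility hypothesis makes b an integer with
-- 7^k ∣ b². Up to constants, the k BFS steps move b² words: the exchanged volume grows by 7/4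
-- from one level to the next, so the last level dominates. They send k messages, and the local
-- multiplications, of cost b^ω, dominate all additions. The ℓ DFS steps repeat this 7^ℓ times,
-- so the costs are Θ(7^ℓ b^ω), Θ(7^ℓ b²) and Θ(7^ℓ k). Finally 2^ℓ is max(1, n/(P^(1/ω) M^(1/2)))
-- up to a constant, which turns these into the stated expressions.

module Submission where

open import Defs
open import Algebra.Bundles using (CommutativeRing)
import Algebra.Properties.Ring as RingProperties
import Algebra.Properties.Semiring.Mult as SemiringMult
import Algebra.Solver.Ring.NaturalCoefficients.Default as NaturalCoefficients
open import Data.Empty using (⊥-elim)
open import Data.Fin.Base as Fin using (Fin)
import Data.Fin.Properties as Fin
open import Data.Integer.Base as ℤ using (+_; -[1+_]; 0ℤ)
import Data.Integer.Properties as ℤ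
open import Data.List.Base as List using (List; []; _∷_; _++_; allFin; concatMap; length; foldr)
open import Data.List.Membership.Propositional using (_∈_)
import Data.List.Membership.Propositional.Properties as ∈
import Data.List.Properties as List
open import Data.List.Relation.Binary.Permutation.Propositional using (↭-sym)
open import Data.List.Relation.Binary.Permutation.Propositional.Properties using (∈-resp-↭)
import Data.List.Relation.Unary.All as All
open import Data.List.Relation.Unary.AllPairs using ([]; _∷_)
open import Data.List.Relation.Unary.Any using (here; there)
open import Data.List.Relation.Unary.Unique.Propositional using (Unique)
import Data.List.Relation.Unary.Unique.Propositional.Properties as Unique
open import Data.Nat.Base as ℕ using (ℕ; zero; suc; NonZero; z≤n; s≤s; ⌈_/2⌉)
open import Data.Nat.Divisibility using (_∣_; divides; ∣-trans; quotient)
open import Data.Nat.DivMod using (_/_; m*n/n≡m)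
open import Data.Nat.ListAction using (sum)
import Data.Nat.Properties as ℕ
import Data.Nat.Tactic.RingSolver as ℕ-Solver
open import Data.Product.Base using (∃-syntax; _×_; _,_; proj₁; proj₂)
open import Data.Sum.Base using (_⊎_; inj₁; inj₂)
open import Data.Vec.Base as Vec using ([]; _∷_)
import Data.Vec.Properties as Vec
open import Function.Base using (id; _∘_)
open import Function.Bundles using (Equivalence)
open import Level using (Level)
open import Relation.Binary.Definitions using (DecidableEquality)
open import Relation.Binary.PropositionalEquality as ≡ using (_≡_; _≢_)
open import Relation.Nullary using (¬_; yes; no; contradiction; ¬?)
open import Relation.Nullary.Decidable using (dec-true; dec-false)

-- The schedule of an exchange is arbitrary, so the clocks need not agree after it, and exact costs
-- are out of reach. Instead all clocks are kept in one interval. Its two ends obey the same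
-- recurrence and differ only in the price of an exchange: one message below, all messages in
-- sequence above. Flops, words and messages are three instances of this recurrence. The order on
-- the reals is not decidable. Whether the maximum in `ℓ` is attained by 0 or by the logarithm is
-- therefore read off from the sign of the integer ceiling. The comparison with the stated
-- expressions writes every power as a power of 2, which leaves polynomial identities between
-- exponents. The solver knows no subtraction, so `δ` and `θ`, which are differences, enter only
-- through `δ+2≈ω` and `θ+ν≈`.

-- Ordered fields without a decidable order

module OrderedFieldProperties {c ℓ₁ ℓ₂ ℓ₃} (F : OrderedField c ℓ₁ ℓ₂ ℓ₃) where
  open OrderedField F
  private module R = CommutativeRing commutativeRing
  open RingProperties R.ring using (-‿distribˡ-*; -0#≈0#)
  open SemiringMult R.semiring using (×-homo-+; ×1-homo-*)
  module Solver = NaturalCoefficients R.commutativeSemiring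

  x-y+y≈x : ∀ x y → x - y + y ≈ x
  x-y+y≈x x y = trans (+-assoc x (- y) y) (trans (+-congˡ (-‿inverseˡ y)) (+-identityʳ x))

  #⇒<⊎> : ∀ {x y} → x # y → x < y ⊎ y < x
  #⇒<⊎> = Equivalence.to #⇔<⊎>

  <-cotrans : ∀ {x z} → x < z → ∀ y → x < y ⊎ y < z
  <-cotrans x<z y with #-cotrans (Equivalence.from #⇔<⊎> (inj₁ x<z)) y
  ... | inj₁ x#y with #⇒<⊎> x#y
  ...   | inj₁ x<y = inj₁ x<y
  ...   | inj₂ y<x = inj₂ (<-trans y<x x<z)
  <-cotrans x<z y | inj₂ y#z with #⇒<⊎> y#z
  ...   | inj₁ y<z = inj₂ y<z
  ...   | inj₂ z<y = inj₁ (<-trans x<z z<y)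

  ≤-trans : ∀ {x y z} → x ≤ y → y ≤ z → x ≤ z
  ≤-trans {y = y} x≤y y≤z z<x with <-cotrans z<x y
  ... | inj₁ z<y = y≤z z<y
  ... | inj₂ y<x = x≤y y<x

  ≤-reflexive : ∀ {x y} → x ≈ y → x ≤ y
  ≤-reflexive x≈y = <-irrefl (sym x≈y)

  ≤-refl : ∀ {x} → x ≤ x
  ≤-refl = ≤-reflexive refl

  <⇒≤ : ∀ {x y} → x < y → x ≤ y
  <⇒≤ x<y y<x = <-irrefl refl (<-trans x<y y<x)

  <-≤-trans : ∀ {x y z} → x < y → y ≤ z → x < z
  <-≤-trans {z = z} x<y y≤z with <-cotrans x<y z
  ... | inj₁ x<z = x<z
  ... | inj₂ z<y = ⊥-elim (y≤z z<y)

  +-cancelʳ-< : ∀ {x y} z → x + z < y + z → x < y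
  +-cancelʳ-< {x} {y} z x+z<y+z =
    <-respˡ-≈ (cancel x) (<-respʳ-≈ (cancel y) (+-monoˡ-< (- z) x+z<y+z))
    where
    cancel : ∀ w → w + z - z ≈ w
    cancel w = trans (+-assoc w z (- z)) (trans (+-congˡ (-‿inverseʳ z)) (+-identityʳ w))

  +-monoˡ-≤ : ∀ {x y} z → x ≤ y → x + z ≤ y + z
  +-monoˡ-≤ z x≤y y+z<x+z = x≤y (+-cancelʳ-< z y+z<x+z)

  +-monoʳ-≤ : ∀ {x y} z → x ≤ y → z + x ≤ z + y
  +-monoʳ-≤ {x} {y} z x≤y =
    ≤-trans (≤-reflexive (+-comm z x)) (≤-trans (+-monoˡ-≤ z x≤y) (≤-reflexive (+-comm y z)))

  +-mono-≤ : ∀ {w x y z} → w ≤ x → y ≤ z → w + y ≤ x + z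
  +-mono-≤ {x = x} {y = y} w≤x y≤z = ≤-trans (+-monoˡ-≤ y w≤x) (+-monoʳ-≤ x y≤z)

  +-nonNeg : ∀ {x y} → 0# ≤ x → 0# ≤ y → 0# ≤ x + y
  +-nonNeg 0≤x 0≤y = ≤-trans (≤-reflexive (sym (+-identityˡ 0#))) (+-mono-≤ 0≤x 0≤y)

  x≤x+y : ∀ {x y} → 0# ≤ y → x ≤ x + y
  x≤x+y {x} 0≤y = ≤-trans (≤-reflexive (sym (+-identityʳ x))) (+-monoʳ-≤ x 0≤y)

  x≤y+x : ∀ {x y} → 0# ≤ y → x ≤ y + x
  x≤y+x {x} 0≤y = ≤-trans (≤-reflexive (sym (+-identityˡ x))) (+-monoˡ-≤ x 0≤y)

  x<y⇒0<y-x : ∀ {x y} → x < y → 0# < y - x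
  x<y⇒0<y-x {x} x<y = <-respˡ-≈ (-‿inverseʳ x) (+-monoˡ-< (- x) x<y)

  *-monoˡ-<-pos : ∀ {x y z} → 0# < z → x < y → x * z < y * z
  *-monoˡ-<-pos {x} {y} {z} 0<z x<y =
    +-cancelʳ-< (- (x * z)) (<-respˡ-≈ (sym (-‿inverseʳ (x * z)))
      (<-respʳ-≈ (trans (distribʳ z y (- x)) (+-congˡ (sym (-‿distribˡ-* x z))))
        (*-pos (x<y⇒0<y-x x<y) 0<z)))

  *-cancelʳ-<-pos : ∀ {x y z} → 0# < z → x * z < y * z → x < y
  *-cancelʳ-<-pos {x} {y} {z} 0<z xz<yz =
    <-respˡ-≈ (cancel x) (<-respʳ-≈ (cancel y) (*-monoˡ-<-pos (⁻¹-pos z⁺) xz<yz))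
    where
    z⁺ = z , 0<z
    cancel : ∀ w → w * z * z⁺ ⁻¹ ≈ w
    cancel w = trans (*-assoc w z _) (trans (*-congˡ (proj₂ (inverse z⁺))) (*-identityʳ w))

  -- Since ≤ is a negated statement, it may be proved by cases on whether z is positive.
  *-monoˡ-≤ : ∀ {x y z} → 0# ≤ z → x ≤ y → x * z ≤ y * z
  *-monoˡ-≤ {x} {y} {z} 0≤z x≤y yz<xz = ¬0<z λ 0≈z →
    <-irrefl refl (<-respˡ-≈ (zero·z y 0≈z) (<-respʳ-≈ (zero·z x 0≈z) yz<xz))
    where
    zero·z : ∀ w → 0# ≈ z → w * z ≈ 0#
    zero·z w 0≈z = trans (*-congˡ (sym 0≈z)) (zeroʳ w)
    ¬0<z : ¬ ¬ (0# ≈ z)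
    ¬0<z 0≉z = 0≉z (proj₁ (tight 0# z) λ 0#z → case (#⇒<⊎> 0#z))
      where
      case : ¬ (0# < z ⊎ z < 0#)
      case (inj₁ 0<z) = x≤y (*-cancelʳ-<-pos 0<z yz<xz)
      case (inj₂ z<0) = 0≤z z<0

  *-monoʳ-≤ : ∀ {x y z} → 0# ≤ z → x ≤ y → z * x ≤ z * y
  *-monoʳ-≤ {x} {y} {z} 0≤z x≤y =
    ≤-trans (≤-reflexive (*-comm z x)) (≤-trans (*-monoˡ-≤ 0≤z x≤y) (≤-reflexive (*-comm y z)))

  *-nonNeg : ∀ {x y} → 0# ≤ x → 0# ≤ y → 0# ≤ x * y
  *-nonNeg {y = y} 0≤x 0≤y = ≤-trans (≤-reflexive (sym (zeroˡ y))) (*-monoˡ-≤ 0≤y 0≤x)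

  x≤x⊔y : ∀ x y → x ≤ x ⊔ y
  x≤x⊔y x y = proj₁ (⊔-supremum x y)

  y≤x⊔y : ∀ x y → y ≤ x ⊔ y
  y≤x⊔y x y = proj₁ (proj₂ (⊔-supremum x y))

  ⊔-least : ∀ {x y z} → x ≤ z → y ≤ z → x ⊔ y ≤ z
  ⊔-least {x} {y} {z} = proj₂ (proj₂ (⊔-supremum x y)) z

  *-inverseʳ : (x : ℝ⁺) → proj₁ x * x ⁻¹ ≈ 1#
  *-inverseʳ x = proj₂ (inverse x)

  ÷-*-cancel : ∀ x y → (x ÷ y) * proj₁ y ≈ x
  ÷-*-cancel x y = trans (*-assoc x _ _)
    (trans (*-congˡ (trans (*-comm _ _) (*-inverseʳ y))) (*-identityʳ x))

  *-÷-cancel : ∀ x y → x * proj₁ y ÷ y ≈ x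
  *-÷-cancel x y = trans (*-assoc x _ _) (trans (*-congˡ (*-inverseʳ y)) (*-identityʳ x))

  *≈⇒≈÷ : ∀ {x z} y → x * proj₁ y ≈ z → x ≈ z ÷ y
  *≈⇒≈÷ y xy≈z = trans (sym (*-÷-cancel _ y)) (*-congʳ xy≈z)

  fromℕ-+ : ∀ m n → fromℕ (m ℕ.+ n) ≈ fromℕ m + fromℕ n
  fromℕ-+ = ×-homo-+ 1#

  fromℕ-* : ∀ m n → fromℕ (m ℕ.* n) ≈ fromℕ m * fromℕ n
  fromℕ-* = ×1-homo-*

  0≤fromℕ : ∀ n → 0# ≤ fromℕ n
  0≤fromℕ zero    = ≤-refl
  0≤fromℕ (suc n) = +-nonNeg (<⇒≤ 0<1) (0≤fromℕ n)

  fromℕ-mono-≤ : ∀ {m n} → m ℕ.≤ n → fromℕ m ≤ fromℕ n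
  fromℕ-mono-≤ {n = n} z≤n       = 0≤fromℕ n
  fromℕ-mono-≤         (s≤s m≤n) = +-monoʳ-≤ 1# (fromℕ-mono-≤ m≤n)

  Θ-trans : ∀ {i} {I : Set i} {f g h : I → Carrier} → Θ f g → Θ g h → Θ f h
  Θ-trans (a⁺@(a , 0<a) , b⁺@(b , 0<b) , fg) (a′⁺@(a′ , _) , b′⁺@(b′ , _) , gh) =
    a⁺ *⁺ a′⁺ , b⁺ *⁺ b′⁺ , λ i →
      ≤-trans (≤-reflexive (*-assoc a a′ _))
        (≤-trans (*-monoʳ-≤ (<⇒≤ 0<a) (proj₁ (gh i))) (proj₁ (fg i)))
    , ≤-trans (proj₂ (fg i))
        (≤-trans (*-monoʳ-≤ (<⇒≤ 0<b) (proj₂ (gh i))) (≤-reflexive (sym (*-assoc b b′ _))))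

  Θ-scaled : ∀ {i} {I : Set i} {f g : I → Carrier} (a : ℝ⁺) → (∀ i → f i ≈ proj₁ a * g i) → Θ f g
  Θ-scaled a f≈ = a , a , λ i → ≤-reflexive (sym (f≈ i)) , ≤-reflexive (f≈ i)

  Θ-≈ : ∀ {i} {I : Set i} {f g : I → Carrier} → (∀ i → f i ≈ g i) → Θ f g
  Θ-≈ f≈g = Θ-scaled (1# , 0<1) λ i → trans (f≈g i) (sym (*-identityˡ _))

-- Processors and schedules

∈-allProcessors : ∀ {k} (p : Processor k) → p ∈ allProcessors k
∈-allProcessors []      = here ≡.refl
∈-allProcessors (d ∷ p) = ∈.∈-cartesianProductWith⁺ _∷_ (∈.∈-allFin d) (∈-allProcessors p)

allProcessors-unique : ∀ k → Unique (allProcessors k)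
allProcessors-unique zero    = All.[] ∷ []
allProcessors-unique (suc k) =
  Unique.cartesianProductWith⁺ _∷_ Vec.∷-injective (Unique.allFin⁺ 7) (allProcessors-unique k)

-- One message sent by each participant suffices for the lower bound of an exchange; the others only
-- affect the constant.
schedule-covers : (schedule : Schedule) → ∀ a → ∃[ b ] (a , b) ∈ proj₁ schedule
schedule-covers (σ , σ↭pairs) a = other a , ∈-resp-↭ (↭-sym σ↭pairs)
  (∈.∈-filter⁺ (λ (a , b) → ¬? (a Fin.≟ b))
    (∈.∈-cartesianProduct⁺ (∈.∈-allFin a) (∈.∈-allFin (other a))) (a≢other a))
  where
  other : Fin 7 → Fin 7
  other Fin.zero    = Fin.suc Fin.zero
  other (Fin.suc _) = Fin.zero
  a≢other : ∀ a → a ≢ other a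
  a≢other Fin.zero    ()
  a≢other (Fin.suc _) ()

-- Bounds on the clocks during an execution

module Phases {c ℓ₁ ℓ₂ ℓ₃} (𝓡 : RealNumbers c ℓ₁ ℓ₂ ℓ₃) {Proc : Set} (_≟_ : DecidableEquality Proc) where
  open RealNumbers 𝓡
  open OrderedFieldProperties orderedField
  open Machine 𝓡 _≟_

  module _ {weight : Event → ℝ} where

    -- An interval rather than an exact advance: what an exchange adds to the clocks of its
    -- participants depends on the schedule.
    record Phase (D : Proc → Set) (es : List Event) (l u : ℝ) : Set (c Level.⊔ ℓ₃) where
      field
        frame  : ∀ t q → ¬ D q → run weight t es q ≡ t q
        bounds : ∀ t x y → (∀ q → D q → x ≤ t q × t q ≤ y) →
                 ∀ q → D q → x + l ≤ run weight t es q × run weight t es q ≤ y + u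
    open Phase

    run-++ : ∀ t es fs q → run weight t (es ++ fs) q ≡ run weight (run weight t es) fs q
    run-++ t es fs q = ≡.cong (λ t′ → t′ q) (List.foldl-++ (tick weight) t es fs)

    phase-resp : ∀ {D D′ es l l′ u u′} → (∀ q → D q → D′ q) → (∀ q → D′ q → D q) →
                 l′ ≤ l → u ≤ u′ → Phase D es l u → Phase D′ es l′ u′
    phase-resp D⊆D′ D′⊆D l′≤l u≤u′ ph .frame t q q∉D′ = frame ph t q (q∉D′ ∘ D⊆D′ q)
    phase-resp D⊆D′ D′⊆D l′≤l u≤u′ ph .bounds t x y t∈[x,y] q q∈D′ =
      let lower , upper = bounds ph t x y (λ r → t∈[x,y] r ∘ D⊆D′ r) q (D′⊆D q q∈D′)
      in  ≤-trans (+-monoʳ-≤ x l′≤l) lower , ≤-trans upper (+-monoʳ-≤ y u≤u′)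

    phase-≈ : ∀ {D es l l′ u u′} → l ≈ l′ → u ≈ u′ → Phase D es l u → Phase D es l′ u′
    phase-≈ l≈l′ u≈u′ =
      phase-resp (λ _ → id) (λ _ → id) (≤-reflexive (sym l≈l′)) (≤-reflexive u≈u′)

    phase-[] : ∀ {D} → Phase D [] 0# 0#
    phase-[] .frame t q _ = ≡.refl
    phase-[] .bounds t x y t∈[x,y] q q∈D =
      ≤-trans (≤-reflexive (+-identityʳ x)) (proj₁ (t∈[x,y] q q∈D))
      , ≤-trans (proj₂ (t∈[x,y] q q∈D)) (≤-reflexive (sym (+-identityʳ y)))

    infixr 5 _⨟_

    _⨟_ : ∀ {D es fs l l′ u u′} →
          Phase D es l u → Phase D fs l′ u′ → Phase D (es ++ fs) (l + l′) (u + u′)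
    _⨟_ {es = es} {fs} ph ph′ .frame t q q∉D =
      ≡.trans (run-++ t es fs q) (≡.trans (frame ph′ _ q q∉D) (frame ph t q q∉D))
    _⨟_ {es = es} {fs} {l} {l′} {u} {u′} ph ph′ .bounds t x y t∈[x,y] q q∈D
      rewrite run-++ t es fs q =
      let lower , upper = bounds ph′ (run weight t es) (x + l) (y + u) (bounds ph t x y t∈[x,y]) q q∈D
      in  ≤-trans (≤-reflexive (sym (+-assoc x l l′))) lower
        , ≤-trans upper (≤-reflexive (+-assoc y u u′))

    phase-sequence : ∀ {I : Set} {D} {B : I → List Event} {l u : I → ℝ} →
      (∀ i → Phase D (B i) (l i) (u i)) → ∀ is →
      Phase D (concatMap B is) (foldr (λ i x → l i + x) 0# is) (foldr (λ i x → u i + x) 0# is)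
    phase-sequence ph []       = phase-[]
    phase-sequence ph (i ∷ is) = ph i ⨟ phase-sequence ph is

    -- Parallelism: although the blocks stand one after the other in the list, each clock is moved
    -- by a single block. By `frame` all other blocks leave it alone, so the advances do not add up.
    phase-parallel : ∀ {I : Set} {D : I → Proc → Set} {B : I → List Event} {l u} →
      (∀ {i j q} → D i q → D j q → i ≡ j) →
      (∀ i → Phase (D i) (B i) l u) → ∀ {is} → Unique is →
      Phase (λ q → ∃[ i ] i ∈ is × D i q) (concatMap B is) l u
    phase-parallel disjoint ph [] .frame t q _ = ≡.refl
    phase-parallel disjoint ph [] .bounds _ _ _ _ _ (_ , () , _)
    phase-parallel {D = D} {B} disjoint ph {i ∷ is} (i∉is ∷ is!) .frame t q q∉D =
      ≡.trans (run-++ t (B i) (concatMap B is) q)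
        (≡.trans (frame (phase-parallel disjoint ph is!) _ q λ (j , j∈is , q∈Dj) → q∉D (j , there j∈is , q∈Dj))
          (frame (ph i) t q λ q∈Di → q∉D (i , here ≡.refl , q∈Di)))
    phase-parallel {D = D} {B} disjoint ph {i ∷ is} (i∉is ∷ is!) .bounds t x y t∈[x,y] q q∈D
      rewrite run-++ t (B i) (concatMap B is) q = go q∈D
      where
      i-then-is = phase-parallel disjoint ph is!
      i-elsewhere : ∀ {q} → ∃[ j ] j ∈ is × D j q → ¬ D i q
      i-elsewhere (j , j∈is , q∈Dj) q∈Di = All.lookup i∉is j∈is (disjoint q∈Di q∈Dj)
      t′ = run weight t (B i)
      go : ∃[ j ] j ∈ i ∷ is × D j q →
           x + _ ≤ run weight t′ (concatMap B is) q × run weight t′ (concatMap B is) q ≤ y + _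
      go (_ , here ≡.refl , q∈Di)
        -- Here `q` belongs to the block that runs now, and the later blocks do not touch it.
        rewrite frame i-then-is t′ q (λ q∈is → i-elsewhere q∈is q∈Di) =
        bounds (ph i) t x y (λ r r∈Di → t∈[x,y] r (i , here ≡.refl , r∈Di)) q q∈Di
      go (j , there j∈is , q∈Dj) = bounds i-then-is t′ x y t′∈[x,y] q (j , j∈is , q∈Dj)
        where
        t′∈[x,y] : ∀ r → ∃[ j ] j ∈ is × D j r → x ≤ t′ r × t′ r ≤ y
        t′∈[x,y] r r∈is@(j , j∈is , r∈Dj)
          rewrite frame (ph i) t r (i-elsewhere r∈is) = t∈[x,y] r (j , there j∈is , r∈Dj)

    phase-compute : ∀ p x → Phase (p ≡_) (compute p x ∷ []) (weight (compute p x)) (weight (compute p x))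
    phase-compute p x .frame t q p≢q rewrite dec-false (p ≟ q) p≢q = ≡.refl
    phase-compute p x .bounds t a b t∈[a,b] q ≡.refl rewrite dec-true (p ≟ p) ≡.refl =
      +-monoˡ-≤ _ (proj₁ (t∈[a,b] p ≡.refl)) , +-monoˡ-≤ _ (proj₂ (t∈[a,b] p ≡.refl))

    module _ (0≤message : ∀ p q w → 0# ≤ weight (message p q w)) where

      tick-message-≥ : ∀ t p q w r → t r ≤ tick weight t (message p q w) r
      tick-message-≥ t p q w r with q ≟ r | p ≟ r
      ... | yes ≡.refl | _          = ≤-trans (y≤x⊔y (t p) (t q)) (x≤x+y (0≤message p q w))
      ... | no _       | yes ≡.refl = ≤-trans (x≤x⊔y (t p) (t q)) (x≤x+y (0≤message p q w))
      ... | no _       | no _       = ≤-refl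

      tick-message-sender : ∀ t p q w →
        t p + weight (message p q w) ≤ tick weight t (message p q w) p
      tick-message-sender t p q w with q ≟ p | p ≟ p
      ... | yes _ | _     = +-monoˡ-≤ _ (x≤x⊔y (t p) (t q))
      ... | no _  | yes _ = +-monoˡ-≤ _ (x≤x⊔y (t p) (t q))
      ... | no _  | no p≢p = contradiction ≡.refl p≢p

      tick-message-≤ : ∀ t p q w r {y} → t p ≤ y → t q ≤ y → t r ≤ y →
        tick weight t (message p q w) r ≤ y + weight (message p q w)
      tick-message-≤ t p q w r tp≤y tq≤y tr≤y with q ≟ r | p ≟ r
      ... | yes _ | _     = +-monoˡ-≤ _ (⊔-least tp≤y tq≤y)
      ... | no _  | yes _ = +-monoˡ-≤ _ (⊔-least tp≤y tq≤y)
      ... | no _  | no _  = ≤-trans tr≤y (x≤x+y (0≤message p q w))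

      tick-message-frame : ∀ t p q w r → p ≢ r → q ≢ r → tick weight t (message p q w) r ≡ t r
      tick-message-frame t p q w r p≢r q≢r
        rewrite dec-false (q ≟ r) q≢r | dec-false (p ≟ r) p≢r = ≡.refl

      module _ {A : Set} (e : A → Proc) (w : ℕ) {μ : ℝ}
               (message≈μ : ∀ a b → weight (message (e a) (e b) w) ≈ μ) where

        messagesAlong : List (A × A) → List Event
        messagesAlong = List.map (λ (a , b) → message (e a) (e b) w)

        run-messages-frame : ∀ σ t r → ¬ (∃[ a ] e a ≡ r) → run weight t (messagesAlong σ) r ≡ t r
        run-messages-frame []            t r _   = ≡.refl
        run-messages-frame ((a , b) ∷ σ) t r r∉e =
          ≡.trans (run-messages-frame σ _ r r∉e)
            (tick-message-frame t (e a) (e b) w r (λ ea≡r → r∉e (a , ea≡r)) (λ eb≡r → r∉e (b , eb≡r)))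

        run-messages-≥ : ∀ σ t r → t r ≤ run weight t (messagesAlong σ) r
        run-messages-≥ []            t r = ≤-refl
        run-messages-≥ ((a , b) ∷ σ) t r =
          ≤-trans (tick-message-≥ t (e a) (e b) w r) (run-messages-≥ σ _ r)

        run-messages-sender : ∀ {a b} σ t → (a , b) ∈ σ →
          t (e a) + μ ≤ run weight t (messagesAlong σ) (e a)
        run-messages-sender {a} {b} (_ ∷ σ) t (here ≡.refl) =
          ≤-trans (+-monoʳ-≤ _ (≤-reflexive (sym (message≈μ a b))))
            (≤-trans (tick-message-sender t (e a) (e b) w) (run-messages-≥ σ _ (e a)))
        run-messages-sender {a} ((a′ , b′) ∷ σ) t (there ab∈σ) =
          ≤-trans (+-monoˡ-≤ _ (tick-message-≥ t (e a′) (e b′) w (e a)))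
            (run-messages-sender σ _ ab∈σ)

        -- The worst case is that no two messages overlap. A message sets two clocks to their
        -- maximum plus `μ`, so it raises a common upper bound by at most `μ`.
        run-messages-≤ : ∀ σ t y → (∀ a → t (e a) ≤ y) →
          ∀ a → run weight t (messagesAlong σ) (e a) ≤ y + fromℕ (length σ) * μ
        run-messages-≤ []              t y t≤y a =
          ≤-trans (t≤y a) (≤-reflexive (sym (trans (+-congˡ (zeroˡ μ)) (+-identityʳ y))))
        run-messages-≤ ((a′ , b′) ∷ σ) t y t≤y a =
          ≤-trans
            (run-messages-≤ σ _ (y + μ)
              (λ a → ≤-trans (tick-message-≤ t (e a′) (e b′) w (e a) (t≤y a′) (t≤y b′) (t≤y a))
                             (+-monoʳ-≤ y (≤-reflexive (message≈μ a′ b′))))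
              a)
            (≤-reflexive (trans (+-assoc y μ _)
              (+-congˡ (sym (trans (distribʳ μ 1# _) (+-congʳ (*-identityˡ μ)))))))

        phase-messages : ∀ σ → (∀ a → ∃[ b ] (a , b) ∈ σ) →
          Phase (λ q → ∃[ a ] e a ≡ q) (messagesAlong σ) μ (fromℕ (length σ) * μ)
        phase-messages σ covers .frame t q q∉e = run-messages-frame σ t q q∉e
        phase-messages σ covers .bounds t x y t∈[x,y] q (a , ≡.refl) =
          ≤-trans (+-monoˡ-≤ μ (proj₁ (t∈[x,y] (e a) (a , ≡.refl))))
            (run-messages-sender σ t (proj₂ (covers a)))
          , run-messages-≤ σ t y (λ a → proj₂ (t∈[x,y] (e a) (a , ≡.refl))) a

    criticalPath-≥ : ∀ ps es {p} → p ∈ ps → run weight (λ _ → 0#) es p ≤ criticalPath weight ps es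
    criticalPath-≥ (p ∷ ps) es (here ≡.refl) = x≤x⊔y _ _
    criticalPath-≥ (p ∷ ps) es (there p∈ps)  = ≤-trans (criticalPath-≥ ps es p∈ps) (y≤x⊔y _ _)

    criticalPath-≤ : ∀ ps es {u} → 0# ≤ u → (∀ p → run weight (λ _ → 0#) es p ≤ u) →
      criticalPath weight ps es ≤ u
    criticalPath-≤ []       es 0≤u run≤u = 0≤u
    criticalPath-≤ (p ∷ ps) es 0≤u run≤u = ⊔-least (run≤u p) (criticalPath-≤ ps es 0≤u run≤u)

    -- 0 ≤ l also yields 0 ≤ u, which is needed because criticalPath takes its maximum with 0#.
    criticalPath-bounds : ∀ {D es l u ps p} → Phase D es l u → (∀ q → D q) → p ∈ ps → 0# ≤ l →
      l ≤ criticalPath weight ps es × criticalPath weight ps es ≤ u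
    criticalPath-bounds {es = es} {l} {u} {ps} {p} ph all p∈ps 0≤l =
      ≤-trans (proj₁ (clock p)) (criticalPath-≥ ps es p∈ps)
      , criticalPath-≤ ps es (≤-trans 0≤l (≤-trans (proj₁ (clock p)) (proj₂ (clock p)))) (λ q → proj₂ (clock q))
      where
      clock : ∀ q → l ≤ run weight (λ _ → 0#) es q × run weight (λ _ → 0#) es q ≤ u
      clock q = let lower , upper = bounds ph (λ _ → 0#) 0# 0# (λ _ _ → ≤-refl , ≤-refl) q (all q) in
        ≤-trans (≤-reflexive (sym (+-identityˡ l))) lower , ≤-trans upper (≤-reflexive (+-identityˡ u))

-- Recurrences for the cost of CAPS

-- This number is 42, but it is never evaluated: the constants only have to be independent of the
-- admissible parameters.
messageCount : Schedule → ℕ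
messageCount schedule = length (proj₁ schedule)

module CAPSPhases {c ℓ₁ ℓ₂ ℓ₃} (𝓡 : RealNumbers c ℓ₁ ℓ₂ ℓ₃)
  (cₛ : RealNumbers.ℝ 𝓡) (schedule : Schedule) (k : ℕ) where
  open RealNumbers 𝓡
  open OrderedFieldProperties orderedField
  open CAPS 𝓡
  open Algorithm cₛ schedule k
  open Phases 𝓡 {Processor k} (Vec.≡-dec Fin._≟_)

  -- Clock advances when adding blocks of s words costs γ s each, an exchange of messages of
  -- s words costs ν s, and a product of size m computed on one processor costs φ m.
  bfsCost : (γ ν φ : ℕ → ℝ) → ℕ → ℕ → ℝ
  bfsCost γ ν φ zero    m = φ m
  bfsCost γ ν φ (suc j) m =
    fromℕ 18 * γ (share (suc j) m) + fromℕ 3 * ν (share (suc j) m) + bfsCost γ ν φ j (m / 2)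

  -- Both kinds of step make the 18 block additions. The seven subproblems follow each other in a
  -- DFS step, hence the factor 7, and run side by side in a BFS step, hence the single recursive
  -- term of `bfsCost`. The 3 there counts the families S, T and Q.
  dfsCost : (γ ν φ : ℕ → ℝ) → ℕ → ℕ → ℝ
  dfsCost γ ν φ zero    m = bfsCost γ ν φ k m
  dfsCost γ ν φ (suc ℓ) m = fromℕ 18 * γ (share k m) + fromℕ 7 * dfsCost γ ν φ ℓ (m / 2)

  Image : {A : Set} → (A → Processor k) → Processor k → Set
  Image e q = ∃[ p ] e p ≡ q

  Injective : {A : Set} → (A → Processor k) → Set
  Injective e = ∀ {p q} → e p ≡ e q → p ≡ q

  fromℕ3-* : ∀ x → fromℕ 3 * x ≈ x + (x + x)
  fromℕ3-* x = Solver.solve 1 (λ x → (con 1 :+ (con 1 :+ (con 1 :+ con 0))) :* x := x :+ (x :+ x)) refl x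
    where open Solver

  module _ (weight : Event → ℝ) (γ μ φ : ℕ → ℝ)
           (addition-weight : ∀ p a s → weight (compute p (fromℕ (a ℕ.* s))) ≈ fromℕ a * γ s)
           (leaf-weight : ∀ p m → weight (compute p (sequentialFlops cₛ m)) ≈ φ m)
           (message-weight : ∀ p q s → weight (message p q s) ≈ μ s)
           (0≤μ : ∀ s → 0# ≤ μ s) where

    0≤message : ∀ p q s → 0# ≤ weight (message p q s)
    0≤message p q s = ≤-trans (0≤μ s) (≤-reflexive (sym (message-weight p q s)))

    phase-addBlocks : ∀ {j} (e : Processor j → Processor k) → Injective e → ∀ m a →
      Phase {weight} (Image e) (addBlocks e m a) (fromℕ a * γ (share j m)) (fromℕ a * γ (share j m))
    phase-addBlocks {j} e e-inj m a =
      ≡.subst (λ es → Phase (Image e) es _ _) events≡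
        (phase-resp (λ q (p , _ , ep≡q) → p , ep≡q) (λ q (p , ep≡q) → p , ∈-allProcessors p , ep≡q) ≤-refl ≤-refl
          (phase-parallel (λ ep≡q ep′≡q → e-inj (≡.trans ep≡q (≡.sym ep′≡q)))
            (λ p → phase-≈ (addition-weight (e p) a _) (addition-weight (e p) a _) (phase-compute (e p) _))
            (allProcessors-unique j)))
      where
      add = λ p → compute (e p) (fromℕ (a ℕ.* share j m))
      events≡ : concatMap (λ p → add p ∷ []) (allProcessors j) ≡ addBlocks e m a
      events≡ = ≡.trans (≡.sym (List.concatMap-map List.[_] add (allProcessors j))) (List.concatMap-pure _)

    -- Injectivity of `e` makes the groups of seven disjoint, so their exchanges run in parallel and
    -- the cost is that of one group.
    phase-exchange : ∀ {j} (e : Processor (suc j) → Processor k) → Injective e → ∀ m →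
      Phase {weight} (Image e) (exchange e m)
        (μ (share (suc j) m)) (fromℕ (messageCount schedule) * μ (share (suc j) m))
    phase-exchange {j} e e-inj m =
      phase-resp (λ q (p , _ , a , eap≡q) → a ∷ p , eap≡q)
        (λ { q (a ∷ p , eap≡q) → p , ∈-allProcessors p , a , eap≡q }) ≤-refl ≤-refl
        (phase-parallel
          (λ (a , eap≡q) (b , ebp′≡q) → Vec.∷-injectiveʳ (e-inj (≡.trans eap≡q (≡.sym ebp′≡q))))
          (λ p → phase-messages 0≤message (λ a → e (a ∷ p)) (share (suc j) m)
            (λ a b → message-weight (e (a ∷ p)) (e (b ∷ p)) (share (suc j) m))
            (proj₁ schedule) (schedule-covers schedule))
          (allProcessors-unique j))

    phase-bfs : ∀ {j} (e : Processor j → Processor k) → Injective e → ∀ m →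
      Phase {weight} (Image e) (bfs e m)
        (bfsCost γ μ φ j m) (bfsCost γ (λ s → fromℕ (messageCount schedule) * μ s) φ j m)
    phase-bfs {zero} e e-inj m =
      phase-resp (λ q e≡q → [] , e≡q) (λ { q ([] , e≡q) → e≡q }) ≤-refl ≤-refl
        (phase-≈ (leaf-weight (e []) m) (leaf-weight (e []) m) (phase-compute (e []) _))
    phase-bfs {suc j} e e-inj m =
      phase-≈ (regroup _) (regroup _)
        (phase-addBlocks e e-inj m (total additionsS ℕ.+ total additionsT)
          ⨟ phase-exchange e e-inj m ⨟ phase-exchange e e-inj m
          ⨟ subproblems ⨟ phase-exchange e e-inj m ⨟ phase-addBlocks e e-inj m additionsC)
      where
      subproblems : Phase (Image e) (concatMap (λ i → bfs (λ p → e (i ∷ p)) (m / 2)) (allFin 7)) _ _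
      subproblems =
        phase-resp (λ q (i , _ , p , eip≡q) → i ∷ p , eip≡q)
          (λ { q (i ∷ p , eip≡q) → i , ∈.∈-allFin i , p , eip≡q }) ≤-refl ≤-refl
          (phase-parallel
            (λ (p , eip≡q) (p′ , ei′p′≡q) → Vec.∷-injectiveˡ (e-inj (≡.trans eip≡q (≡.sym ei′p′≡q))))
            (λ i → phase-bfs (λ p → e (i ∷ p)) (λ eip≡eiq → Vec.∷-injectiveʳ (e-inj eip≡eiq)) (m / 2))
            (Unique.allFin⁺ 7))

      combineAdditions : ∀ x →
        fromℕ (total additionsS ℕ.+ total additionsT) * x + fromℕ additionsC * x ≈ fromℕ 18 * x
      combineAdditions x = trans (sym (distribʳ x _ _))
        (*-congʳ (sym (fromℕ-+ (total additionsS ℕ.+ total additionsT) additionsC)))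

      regroup : ∀ {x} y {z} →
        fromℕ (total additionsS ℕ.+ total additionsT) * x + (y + (y + (z + (y + fromℕ additionsC * x))))
        ≈ fromℕ 18 * x + fromℕ 3 * y + z
      regroup {x} y {z} = trans
        (solve 4 (λ a b y z → a :+ (y :+ (y :+ (z :+ (y :+ b)))) := (a :+ b) :+ (y :+ (y :+ y)) :+ z)
          refl _ _ y z)
        (+-congʳ (+-cong (combineAdditions x) (sym (fromℕ3-* y))))
        where open Solver

    -- The seven iterations of a DFS step need different numbers of additions; only their total
    -- enters the cost, and for Strassen's coefficients it evaluates to 18.
    sum-steps : (f g : Fin 7 → ℕ) → ∀ x y is →
      foldr (λ i z → (fromℕ (f i) * x + (y + fromℕ (g i) * x)) + z) 0# is
      ≈ fromℕ (sum (List.map (λ i → f i ℕ.+ g i) is)) * x + fromℕ (length is) * y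
    sum-steps f g x y []       = sym (trans (+-cong (zeroˡ x) (zeroˡ y)) (+-identityˡ 0#))
    sum-steps f g x y (i ∷ is) = trans (+-congˡ (sum-steps f g x y is)) (sym (trans
      (+-congʳ (*-congʳ (trans (fromℕ-+ (f i ℕ.+ g i) _) (+-congʳ (fromℕ-+ (f i) (g i))))))
      (solve 6 (λ a b s n x y → (a :+ b :+ s) :* x :+ (con 1 :+ n) :* y
                             := a :* x :+ (y :+ b :* x) :+ (s :* x :+ n :* y))
        refl (fromℕ (f i)) (fromℕ (g i)) _ (fromℕ (length is)) x y)))
      where open Solver

    phase-dfs : ∀ ℓ m →
      Phase {weight} (Image id) (dfs ℓ m)
        (dfsCost γ μ φ ℓ m) (dfsCost γ (λ s → fromℕ (messageCount schedule) * μ s) φ ℓ m)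
    phase-dfs zero    m = phase-bfs id id m
    phase-dfs (suc ℓ) m = phase-≈ (steps _) (steps _)
      (phase-sequence
        (λ i → phase-addBlocks id id m (additionsS i ℕ.+ additionsT i) ⨟ phase-dfs ℓ (m / 2)
               ⨟ phase-addBlocks id id m (accumulations i))
        (allFin 7))
      where
      steps : ∀ y → _ ≈ fromℕ 18 * γ (share k m) + fromℕ 7 * y
      steps y = sum-steps (λ i → additionsS i ℕ.+ additionsT i) accumulations (γ (share k m)) y (allFin 7)

    execution-bounds : ∀ ℓ m → 0# ≤ dfsCost γ μ φ ℓ m →
      dfsCost γ μ φ ℓ m ≤ criticalPath weight (allProcessors k) (dfs ℓ m)
      × criticalPath weight (allProcessors k) (dfs ℓ m)
        ≤ dfsCost γ (λ s → fromℕ (messageCount schedule) * μ s) φ ℓ m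
    execution-bounds ℓ m =
      criticalPath-bounds (phase-dfs ℓ m) (λ q → q , ≡.refl) (∈-allProcessors (Vec.replicate k Fin.zero))

-- Closed forms of the recurrences

2*m/2≡m : ∀ m → 2 ℕ.* m / 2 ≡ m
2*m/2≡m m = ≡.trans (≡.cong (_/ 2) (ℕ.*-comm 2 m)) (m*n/n≡m m 2)

2^[1+i]*m/2 : ∀ i m → 2 ℕ.^ suc i ℕ.* m / 2 ≡ 2 ℕ.^ i ℕ.* m
2^[1+i]*m/2 i m = ≡.trans (≡.cong (_/ 2) (ℕ.*-assoc 2 (2 ℕ.^ i) m)) (2*m/2≡m _)

[2^i*m]²≡4^i*m² : ∀ i m → (2 ℕ.^ i ℕ.* m) ℕ.* (2 ℕ.^ i ℕ.* m) ≡ 4 ℕ.^ i ℕ.* (m ℕ.* m)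
[2^i*m]²≡4^i*m² zero    m = one m
  where
  one : ∀ m → (1 ℕ.* m) ℕ.* (1 ℕ.* m) ≡ 1 ℕ.* (m ℕ.* m)
  one = ℕ-Solver.solve-∀
[2^i*m]²≡4^i*m² (suc i) m = ≡.trans (double (2 ℕ.^ i) m)
  (≡.trans (≡.cong (4 ℕ.*_) ([2^i*m]²≡4^i*m² i m)) (≡.sym (ℕ.*-assoc 4 (4 ℕ.^ i) (m ℕ.* m))))
  where
  double : ∀ x m → ((2 ℕ.* x) ℕ.* m) ℕ.* ((2 ℕ.* x) ℕ.* m) ≡ 4 ℕ.* ((x ℕ.* m) ℕ.* (x ℕ.* m))
  double = ℕ-Solver.solve-∀

module CostFormulas {c ℓ₁ ℓ₂ ℓ₃} (𝓡 : RealNumbers c ℓ₁ ℓ₂ ℓ₃)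
  (cₛ : RealNumbers.ℝ 𝓡) (schedule : Schedule) (k : ℕ) where
  open RealNumbers 𝓡
  open OrderedFieldProperties orderedField
  open CAPS 𝓡
  open Algorithm cₛ schedule k using (share)
  open CAPSPhases 𝓡 cₛ schedule k

  share-exact : ∀ j m {v} → m ℕ.* m ≡ v ℕ.* (4 ℕ.* 7 ℕ.^ j) → share j m ≡ v
  share-exact j m {v} m²≡ =
    ≡.trans (≡.cong (λ x → _/_ x (4 ℕ.* 7 ℕ.^ j) {{4*7^j≢0}}) m²≡) (m*n/n≡m v _ {{4*7^j≢0}})
    where
    4*7^j≢0 : NonZero (4 ℕ.* 7 ℕ.^ j)
    4*7^j≢0 = ℕ.m*n≢0 4 (7 ℕ.^ j) {{_}} {{ℕ.m^n≢0 7 j}}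

  -- The message sizes of one family, summed over the BFS levels; for the additions, the sizes of
  -- the blocks.
  shareSum : ℕ → ℕ → ℕ
  shareSum zero    m = 0
  shareSum (suc j) m = share (suc j) m ℕ.+ shareSum j (m / 2)

  bfs-share : ∀ j b {d} → b ℕ.* b ≡ 7 ℕ.^ suc j ℕ.* d → share (suc j) (2 ℕ.^ suc j ℕ.* b) ≡ 4 ℕ.^ j ℕ.* d
  bfs-share j b {d} b²≡ = share-exact (suc j) (2 ℕ.^ suc j ℕ.* b)
    (≡.trans ([2^i*m]²≡4^i*m² (suc j) b)
      (≡.trans (≡.cong (4 ℕ.^ suc j ℕ.*_) b²≡) (regroup (4 ℕ.^ j) (7 ℕ.^ suc j) d)))
    where
    regroup : ∀ x y d → (4 ℕ.* x) ℕ.* (y ℕ.* d) ≡ (x ℕ.* d) ℕ.* (4 ℕ.* y)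
    regroup = ℕ-Solver.solve-∀

  -- The sum of the geometric progression (4/7)^i b² / 4, i = 1, …, j, cleared of denominators.
  shareSum-identity : ∀ j b {d} → b ℕ.* b ≡ 7 ℕ.^ j ℕ.* d →
    3 ℕ.* shareSum j (2 ℕ.^ j ℕ.* b) ℕ.+ 4 ℕ.^ j ℕ.* d ≡ b ℕ.* b
  shareSum-identity zero    b b²≡ = ≡.sym b²≡
  shareSum-identity (suc j) b {d} b²≡
    rewrite bfs-share j b {d} b²≡ | 2^[1+i]*m/2 j b =
    ≡.trans (regroup (4 ℕ.^ j) d (shareSum j (2 ℕ.^ j ℕ.* b)))
      (shareSum-identity j b (≡.trans b²≡ (shift (7 ℕ.^ j) d)))
    where
    regroup : ∀ x d y → 3 ℕ.* (x ℕ.* d ℕ.+ y) ℕ.+ (4 ℕ.* x) ℕ.* d ≡ 3 ℕ.* y ℕ.+ x ℕ.* (7 ℕ.* d)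
    regroup = ℕ-Solver.solve-∀
    shift : ∀ x d → (7 ℕ.* x) ℕ.* d ≡ x ℕ.* (7 ℕ.* d)
    shift = ℕ-Solver.solve-∀

  shareSum-≤ : ∀ j b {d} → b ℕ.* b ≡ 7 ℕ.^ j ℕ.* d → 3 ℕ.* shareSum j (2 ℕ.^ j ℕ.* b) ℕ.≤ b ℕ.* b
  shareSum-≤ j b b²≡ = ℕ.≤-trans (ℕ.m≤m+n _ _) (ℕ.≤-reflexive (shareSum-identity j b b²≡))

  -- In `shareSum-identity` the difference between `b ℕ.* b` and three times the sum is four times
  -- the share of the top level, itself one of the summands; hence 7 = 3 + 4. Without any BFS level
  -- the sum would be 0.
  shareSum-≥ : ∀ j b {d} → 1 ℕ.≤ j → b ℕ.* b ≡ 7 ℕ.^ j ℕ.* d →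
    b ℕ.* b ℕ.≤ 7 ℕ.* shareSum j (2 ℕ.^ j ℕ.* b)
  shareSum-≥ (suc j) b {d} _ b²≡ = begin
    b ℕ.* b                         ≡⟨ shareSum-identity (suc j) b b²≡ ⟨
    3 ℕ.* S ℕ.+ 4 ℕ.^ suc j ℕ.* d   ≡⟨ ≡.cong (3 ℕ.* S ℕ.+_) (ℕ.*-assoc 4 (4 ℕ.^ j) d) ⟩
    3 ℕ.* S ℕ.+ 4 ℕ.* (4 ℕ.^ j ℕ.* d)  ≡⟨ ≡.cong (λ v → 3 ℕ.* S ℕ.+ 4 ℕ.* v) (bfs-share j b {d} b²≡) ⟨
    3 ℕ.* S ℕ.+ 4 ℕ.* share (suc j) (2 ℕ.^ suc j ℕ.* b)
                                    ≤⟨ ℕ.+-monoʳ-≤ (3 ℕ.* S) (ℕ.*-monoʳ-≤ 4 s≤S) ⟩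
    3 ℕ.* S ℕ.+ 4 ℕ.* S             ≡⟨ ℕ.*-distribʳ-+ S 3 4 ⟨
    7 ℕ.* S                         ∎
    where
    open ℕ.≤-Reasoning
    S = shareSum (suc j) (2 ℕ.^ suc j ℕ.* b)
    s≤S : share (suc j) (2 ℕ.^ suc j ℕ.* b) ℕ.≤ S
    s≤S = ℕ.m≤m+n (share (suc j) (2 ℕ.^ suc j ℕ.* b)) _

  dfsShareSum : ℕ → ℕ → ℕ
  dfsShareSum zero    m = 0
  dfsShareSum (suc ℓ) m = share k m ℕ.+ 7 ℕ.* dfsShareSum ℓ (m / 2)

  -- At depth i there are 7^i subproblems whose share is 4^(ℓ-i) g, where `g` is the share at the
  -- end of the DFS steps. This is the geometric sum over i < ℓ, of ratio 7/4, cleared of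
  -- denominators.
  dfsShareSum-identity : ∀ ℓ m {g} → m ℕ.* m ≡ g ℕ.* (4 ℕ.* 7 ℕ.^ k) →
    3 ℕ.* dfsShareSum ℓ (2 ℕ.^ ℓ ℕ.* m) ℕ.+ 4 ℕ.* (4 ℕ.^ ℓ ℕ.* g) ≡ 7 ℕ.^ ℓ ℕ.* (4 ℕ.* g)
  dfsShareSum-identity zero    m {g} m²≡ = base g
    where
    base : ∀ g → 4 ℕ.* (1 ℕ.* g) ≡ 1 ℕ.* (4 ℕ.* g)
    base = ℕ-Solver.solve-∀
  dfsShareSum-identity (suc ℓ) m {g} m²≡
    rewrite share-exact k (2 ℕ.^ suc ℓ ℕ.* m) {4 ℕ.^ suc ℓ ℕ.* g}
              (≡.trans ([2^i*m]²≡4^i*m² (suc ℓ) m)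
                (≡.trans (≡.cong (4 ℕ.^ suc ℓ ℕ.*_) m²≡)
                  (≡.sym (ℕ.*-assoc (4 ℕ.^ suc ℓ) g (4 ℕ.* 7 ℕ.^ k)))))
          | 2^[1+i]*m/2 ℓ m =
    ≡.trans (regroup (4 ℕ.^ ℓ) g (dfsShareSum ℓ (2 ℕ.^ ℓ ℕ.* m)))
      (≡.trans (≡.cong (7 ℕ.*_) (dfsShareSum-identity ℓ m {g} m²≡)) (≡.sym (ℕ.*-assoc 7 (7 ℕ.^ ℓ) _)))
    where
    regroup : ∀ x g y → 3 ℕ.* ((4 ℕ.* x) ℕ.* g ℕ.+ 7 ℕ.* y) ℕ.+ 4 ℕ.* ((4 ℕ.* x) ℕ.* g)
                      ≡ 7 ℕ.* (3 ℕ.* y ℕ.+ 4 ℕ.* (x ℕ.* g))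
    regroup = ℕ-Solver.solve-∀

  dfsShareSum-≤ : ∀ ℓ b {d} → 1 ℕ.≤ k → b ℕ.* b ≡ 7 ℕ.^ k ℕ.* d →
    dfsShareSum ℓ (2 ℕ.^ ℓ ℕ.* (2 ℕ.^ k ℕ.* b)) ℕ.≤ 4 ℕ.* (7 ℕ.^ ℓ ℕ.* (b ℕ.* b))
  dfsShareSum-≤ ℓ b {d} 1≤k b²≡ = begin
    X                                ≤⟨ ℕ.m≤m+n X _ ⟩
    3 ℕ.* X                          ≤⟨ ℕ.m≤m+n (3 ℕ.* X) _ ⟩
    3 ℕ.* X ℕ.+ 4 ℕ.* (4 ℕ.^ ℓ ℕ.* g)  ≡⟨ dfsShareSum-identity ℓ (2 ℕ.^ k ℕ.* b) (g-exact k 1≤k b²≡) ⟩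
    7 ℕ.^ ℓ ℕ.* (4 ℕ.* g)            ≤⟨ ℕ.*-monoʳ-≤ (7 ℕ.^ ℓ) (ℕ.*-monoʳ-≤ 4 g≤b²) ⟩
    7 ℕ.^ ℓ ℕ.* (4 ℕ.* (b ℕ.* b))    ≡⟨ swap (7 ℕ.^ ℓ) (b ℕ.* b) ⟩
    4 ℕ.* (7 ℕ.^ ℓ ℕ.* (b ℕ.* b))    ∎
    where
    open ℕ.≤-Reasoning
    X = dfsShareSum ℓ (2 ℕ.^ ℓ ℕ.* (2 ℕ.^ k ℕ.* b))
    -- The share of the first BFS level: as `k` is positive, the 4 in the denominator of `share`
    -- cancels one factor of 4^k.
    g = 4 ℕ.^ ℕ.pred k ℕ.* d
    swap : ∀ x y → x ℕ.* (4 ℕ.* y) ≡ 4 ℕ.* (x ℕ.* y)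
    swap = ℕ-Solver.solve-∀
    g-exact : ∀ j → 1 ℕ.≤ j → b ℕ.* b ≡ 7 ℕ.^ j ℕ.* d →
      (2 ℕ.^ j ℕ.* b) ℕ.* (2 ℕ.^ j ℕ.* b) ≡ 4 ℕ.^ ℕ.pred j ℕ.* d ℕ.* (4 ℕ.* 7 ℕ.^ j)
    g-exact (suc j) _ b²≡ = ≡.trans ([2^i*m]²≡4^i*m² (suc j) b)
      (≡.trans (≡.cong (4 ℕ.^ suc j ℕ.*_) b²≡) (regroup (4 ℕ.^ j) (7 ℕ.^ suc j) d))
      where
      regroup : ∀ x y d → (4 ℕ.* x) ℕ.* (y ℕ.* d) ≡ (x ℕ.* d) ℕ.* (4 ℕ.* y)
      regroup = ℕ-Solver.solve-∀
    g≤b² : g ℕ.≤ b ℕ.* b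
    g≤b² = begin
      4 ℕ.^ ℕ.pred k ℕ.* d ≤⟨ ℕ.*-monoˡ-≤ d (ℕ.^-monoʳ-≤ 4 (ℕ.pred[n]≤n {k})) ⟩
      4 ℕ.^ k ℕ.* d        ≤⟨ ℕ.*-monoˡ-≤ d (ℕ.^-monoˡ-≤ k (ℕ.m≤m+n 4 3)) ⟩
      7 ℕ.^ k ℕ.* d        ≡⟨ b²≡ ⟨
      b ℕ.* b              ∎

  -- The price `ν` stays abstract because it is proportional to the share for words but constant for
  -- messages.
  levelSum : (ℕ → ℝ) → ℕ → ℕ → ℝ
  levelSum ν zero    m = 0#
  levelSum ν (suc j) m = ν (share (suc j) m) + levelSum ν j (m / 2)

  levelSum-linear : ∀ {ν x} → (∀ s → ν s ≈ x * fromℕ s) → ∀ j m → levelSum ν j m ≈ x * fromℕ (shareSum j m)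
  levelSum-linear {x = x} ν≈ zero    m = sym (zeroʳ x)
  levelSum-linear {x = x} ν≈ (suc j) m = trans (+-cong (ν≈ _) (levelSum-linear ν≈ j (m / 2)))
    (trans (sym (distribˡ x _ _)) (*-congˡ (sym (fromℕ-+ (share (suc j) m) (shareSum j (m / 2))))))

  levelSum-constant : ∀ {ν x} → (∀ s → ν s ≈ x) → ∀ j m → levelSum ν j m ≈ x * fromℕ j
  levelSum-constant {x = x} ν≈ zero    m = sym (zeroʳ x)
  levelSum-constant {x = x} ν≈ (suc j) m = trans (+-cong (ν≈ _) (levelSum-constant ν≈ j (m / 2)))
    (trans (+-congʳ (sym (*-identityʳ x))) (sym (distribˡ x 1# (fromℕ j))))

  module _ {γ ν φ : ℕ → ℝ} {y : ℝ} (γ≈ : ∀ s → γ s ≈ y * fromℕ s) where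

    bfsCost-formula : ∀ j b → bfsCost γ ν φ j (2 ℕ.^ j ℕ.* b) ≈
      φ b + (fromℕ 18 * (y * fromℕ (shareSum j (2 ℕ.^ j ℕ.* b))) + fromℕ 3 * levelSum ν j (2 ℕ.^ j ℕ.* b))
    bfsCost-formula zero    b rewrite ℕ.+-identityʳ b =
      sym (trans (+-congˡ (trans (+-cong (trans (*-congˡ (zeroʳ y)) (zeroʳ _)) (zeroʳ _)) (+-identityˡ 0#)))
        (+-identityʳ (φ b)))
    bfsCost-formula (suc j) b rewrite 2^[1+i]*m/2 j b =
      trans (+-cong (+-congʳ (*-congˡ (γ≈ _))) (bfsCost-formula j b))
        (trans
          (solve 8 (λ a y s t n u v f → (a :* (y :* s) :+ n :* u) :+ (f :+ (a :* (y :* t) :+ n :* v))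
                                   := f :+ (a :* (y :* (s :+ t)) :+ n :* (u :+ v)))
            refl _ y _ _ _ _ _ _)
          (+-congˡ (+-congʳ (*-congˡ (*-congˡ (sym (fromℕ-+ (share (suc j) (2 ℕ.^ suc j ℕ.* b)) _)))))))
      where open Solver

    dfsCost-formula : ∀ ℓ m → dfsCost γ ν φ ℓ (2 ℕ.^ ℓ ℕ.* m) ≈
      fromℕ 18 * (y * fromℕ (dfsShareSum ℓ (2 ℕ.^ ℓ ℕ.* m))) + fromℕ (7 ℕ.^ ℓ) * bfsCost γ ν φ k m
    dfsCost-formula zero    m rewrite ℕ.+-identityʳ m =
      sym (trans (+-cong (trans (*-congˡ (zeroʳ y)) (zeroʳ _)) (trans (*-congʳ (+-identityʳ 1#)) (*-identityˡ _)))
        (+-identityˡ _))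
    dfsCost-formula (suc ℓ) m rewrite 2^[1+i]*m/2 ℓ m =
      trans (+-cong (*-congˡ (γ≈ _)) (*-congˡ (dfsCost-formula ℓ m)))
        (trans
          (solve 7 (λ a y s q t u v → a :* (y :* s) :+ q :* (a :* (y :* t) :+ u :* v)
                                 := a :* (y :* (s :+ q :* t)) :+ (q :* u) :* v)
            refl (fromℕ 18) y (fromℕ s) (fromℕ 7) (fromℕ t) (fromℕ (7 ℕ.^ ℓ)) _)
          (+-cong (*-congˡ (*-congˡ (sym (trans (fromℕ-+ s (7 ℕ.* t)) (+-congˡ (fromℕ-* 7 t))))))
            (*-congʳ (sym (fromℕ-* 7 (7 ℕ.^ ℓ))))))
      where
      open Solver
      s = share k (2 ℕ.^ suc ℓ ℕ.* m)
      t = dfsShareSum ℓ (2 ℕ.^ ℓ ℕ.* m)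

0⊔-injective : ∀ {m n} → + m ≡ 0ℤ ℤ.⊔ + n → m ≡ n
0⊔-injective {n = n} m≡0⊔n = ℤ.+-injective (≡.trans m≡0⊔n (ℤ.i≤j⇒i⊔j≡j (ℤ.+≤+ (z≤n {n}))))

^-monoʳ-∣ : ∀ m {i j} → i ℕ.≤ j → m ℕ.^ i ∣ m ℕ.^ j
^-monoʳ-∣ m {i} {j} i≤j = divides (m ℕ.^ (j ℕ.∸ i))
  (≡.trans (≡.cong (m ℕ.^_) (≡.sym (ℕ.m∸n+n≡m i≤j))) (ℕ.^-distribˡ-+-* m (j ℕ.∸ i) i))

-- Real powers and logarithms to base 2

module RealProperties {c ℓ₁ ℓ₂ ℓ₃} (𝓡 : RealNumbers c ℓ₁ ℓ₂ ℓ₃) where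
  open RealNumbers 𝓡
  open OrderedFieldProperties orderedField

  1<2 : 1# < fromℕ 2
  1<2 = <-respʳ-≈ (+-congˡ (sym (+-identityʳ 1#))) (n<1+n 1#)

  2^_ : ℝ → ℝ
  2^ y = proj₁ (ι 2 ^ y)

  2^-cong : ∀ {x y} → x ≈ y → 2^ x ≈ 2^ y
  2^-cong = ^-cong {ι 2} {ι 2} refl

  2^-+ : ∀ x y → 2^ (x + y) ≈ 2^ x * 2^ y
  2^-+ = ^-distribˡ-+-* (ι 2)

  0<2^ : ∀ x → 0# < 2^ x
  0<2^ x = proj₂ (ι 2 ^ x)

  -- The number `2^ 0#` equals its own square and is invertible.
  2^0≈1 : 2^ 0# ≈ 1#
  2^0≈1 = trans (sym (*-÷-cancel (2^ 0#) (ι 2 ^ 0#)))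
    (trans (*-congʳ (sym (trans (2^-cong (sym (+-identityˡ 0#))) (2^-+ 0# 0#)))) (*-inverseʳ (ι 2 ^ 0#)))

  -- By contraposition: strict monotonicity of the inverse function yields weak monotonicity without
  -- comparing `x` and `y`.
  2^-mono-≤ : ∀ {x y} → x ≤ y → 2^ x ≤ 2^ y
  2^-mono-≤ {x} {y} x≤y 2^y<2^x =
    x≤y (<-respˡ-≈ (log₂-2^ y) (<-respʳ-≈ (log₂-2^ x) (log₂-mono-< {ι 2 ^ y} {ι 2 ^ x} 2^y<2^x)))

  1≤2^ : ∀ {x} → 0# ≤ x → 1# ≤ 2^ x
  1≤2^ 0≤x = ≤-trans (≤-reflexive (sym 2^0≈1)) (2^-mono-≤ 0≤x)

  2^log : ∀ x → 2^ log₂ x ≈ proj₁ x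
  2^log = 2^log₂

  log-mono-≤ : ∀ {x y} → proj₁ x ≤ proj₁ y → log₂ x ≤ log₂ y
  log-mono-≤ {x} {y} x≤y ly<lx =
    x≤y (<-respˡ-≈ (2^log y) (<-respʳ-≈ (2^log x) (^-monoʳ-< (ι 2) 1<2 ly<lx)))

  log-* : ∀ x y → log₂ (x *⁺ y) ≈ log₂ x + log₂ y
  log-* x y = trans
    (log₂-cong {x *⁺ y} {ι 2 ^ (log₂ x + log₂ y)}
      (sym (trans (2^-+ _ _) (*-cong (2^log x) (2^log y)))))
    (log₂-2^ _)

  ^≈2^ : ∀ x y → proj₁ (x ^ y) ≈ 2^ (log₂ x * y)
  ^≈2^ x y = trans (^-cong {x} {ι 2 ^ log₂ x} (sym (2^log x)) refl) (^-*-assoc (ι 2) (log₂ x) y)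

  log-^ : ∀ x y → log₂ (x ^ y) ≈ log₂ x * y
  log-^ x y = trans (log₂-cong {x ^ y} {ι 2 ^ (log₂ x * y)} (^≈2^ x y)) (log₂-2^ _)

  log-/⁺ : ∀ x y → log₂ (x /⁺ y) + log₂ y ≈ log₂ x
  log-/⁺ x y = trans (sym (log-* (x /⁺ y) y)) (log₂-cong {(x /⁺ y) *⁺ y} {x} (÷-*-cancel (proj₁ x) y))

  fromℕ-cong : ∀ {m n} → m ≡ n → fromℕ m ≈ fromℕ n
  fromℕ-cong ≡.refl = refl

  ι≈fromℕ : ∀ n .{{_ : NonZero n}} → proj₁ (ι n) ≈ fromℕ n
  ι≈fromℕ (suc n) = refl

  log-ι-cong : ∀ {m n} .{{_ : NonZero m}} .{{_ : NonZero n}} → m ≡ n → log₂ (ι m) ≈ log₂ (ι n)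
  log-ι-cong ≡.refl = refl

  log-ι-* : ∀ m n .{{_ : NonZero m}} .{{_ : NonZero n}} .{{_ : NonZero (m ℕ.* n)}} →
    log₂ (ι (m ℕ.* n)) ≈ log₂ (ι m) + log₂ (ι n)
  log-ι-* m n = trans
    (log₂-cong {ι (m ℕ.* n)} {ι m *⁺ ι n}
      (trans (ι≈fromℕ (m ℕ.* n)) (trans (fromℕ-* m n) (sym (*-cong (ι≈fromℕ m) (ι≈fromℕ n))))))
    (log-* (ι m) (ι n))

  log-2 : log₂ (ι 2) ≈ 1#
  log-2 = trans (sym (log₂-cong {ι 2 ^ 1#} {ι 2} (^-identityʳ (ι 2)))) (log₂-2^ 1#)

  log-1 : log₂ (ι 1) ≈ 0#
  log-1 = trans (log₂-cong {ι 1} {ι 2 ^ 0#} (trans (+-identityʳ 1#) (sym 2^0≈1))) (log₂-2^ 0#)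

  log-ι-^ : ∀ b j .{{_ : NonZero b}} .{{_ : NonZero (b ℕ.^ j)}} → log₂ (ι (b ℕ.^ j)) ≈ fromℕ j * log₂ (ι b)
  log-ι-^ b zero    = trans log-1 (sym (zeroˡ _))
  log-ι-^ b (suc j) = trans (log-ι-* b (b ℕ.^ j) {{_}} {{b^j≢0}})
    (trans (+-cong (sym (*-identityˡ _)) (log-ι-^ b j {{_}} {{b^j≢0}})) (sym (distribʳ _ 1# (fromℕ j))))
    where
    b^j≢0 = ℕ.m^n≢0 b j

  0≤log-ι : ∀ n .{{_ : NonZero n}} → 0# ≤ log₂ (ι n)
  0≤log-ι (suc n) = ≤-trans (≤-reflexive (sym log-1)) (log-mono-≤ {ι 1} {ι (suc n)} (fromℕ-mono-≤ (s≤s (z≤n {n}))))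

  fromℕ-square : ∀ n .{{_ : NonZero n}} → fromℕ (n ℕ.* n) ≈ 2^ (fromℕ 2 * log₂ (ι n))
  fromℕ-square n = trans (fromℕ-* n n)
    (trans (sym (trans (2^-+ _ _) (*-cong n≈ n≈)))
      (2^-cong (solve 1 (λ x → x :+ x := (con 1 :+ (con 1 :+ con 0)) :* x) refl (log₂ (ι n)))))
    where
    open Solver
    n≈ = trans (2^log (ι n)) (ι≈fromℕ n)

  ω : ℝ
  ω = proj₁ ω₀

  2≤ω : fromℕ 2 ≤ ω
  2≤ω = ≤-trans
    (≤-reflexive (sym (trans (log-ι-^ 2 2) (trans (*-congˡ log-2) (*-identityʳ _)))))
    (log-mono-≤ {ι 4} {ι 7} (fromℕ-mono-≤ (ℕ.m≤m+n 4 3)))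

  -- 2^δ = 7/4 is the factor by which a DFS step increases communication: seven subproblems, each of
  -- a quarter of the area.
  δ : ℝ
  δ = ω - fromℕ 2

  δ+2≈ω : δ + fromℕ 2 ≈ ω
  δ+2≈ω = x-y+y≈x ω (fromℕ 2)

  0≤δ : 0# ≤ δ
  0≤δ = ≤-trans (≤-reflexive (sym (-‿inverseʳ _))) (+-monoˡ-≤ _ 2≤ω)

  half : ℝ
  half = ι 2 ⁻¹

  x*½+x*½≈x : ∀ x → x * half + x * half ≈ x
  x*½+x*½≈x x = trans
    (solve 2 (λ x h → x :* h :+ x :* h := x :* ((con 1 :+ (con 1 :+ con 0)) :* h)) refl x half)
    (trans (*-congˡ (*-inverseʳ (ι 2))) (*-identityʳ x))
    where open Solver

  x÷y*y : ∀ a b y → a * proj₁ y * (b ÷ y) ≈ a * b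
  x÷y*y a b y = trans
    (solve 4 (λ a y b i → a :* y :* (b :* i) := a :* b :* (y :* i)) refl a (proj₁ y) b (y ⁻¹))
    (trans (*-congˡ (*-inverseʳ y)) (*-identityʳ _))
    where open Solver

-- Admissible parameters and their logarithms

module AdmissibleProperties {c ℓ₁ ℓ₂ ℓ₃} (𝓡 : RealNumbers c ℓ₁ ℓ₂ ℓ₃) (π : CAPS.Admissible 𝓡) where
  open RealNumbers 𝓡
  open CAPS 𝓡
  open OrderedFieldProperties orderedField
  open RealProperties 𝓡
  open RingProperties (CommutativeRing.ring commutativeRing) using (+-cancelʳ)
  open Admissible π

  -- The size of the subproblems solved on one processor.
  b : ℕ
  b = quotient divisible ℕ.* 7 ℕ.^ ⌈ k /2⌉

  n≡ : n ≡ 2 ℕ.^ ℓ ℕ.* (2 ℕ.^ k ℕ.* b)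
  n≡ = ≡.trans (_∣_.equality divisible)
    (≡.trans (≡.cong (λ x → quotient divisible ℕ.* (x ℕ.* 7 ℕ.^ ⌈ k /2⌉))
      (≡.trans (≡.cong (2 ℕ.^_) s≡ℓ+k) (ℕ.^-distribˡ-+-* 2 ℓ k)))
      (regroup (quotient divisible) (2 ℕ.^ ℓ) (2 ℕ.^ k) (7 ℕ.^ ⌈ k /2⌉)))
    where
    regroup : ∀ q x y z → q ℕ.* (x ℕ.* y ℕ.* z) ≡ x ℕ.* (y ℕ.* (q ℕ.* z))
    regroup = ℕ-Solver.solve-∀

  -- Squaring doubles the exponent ⌈k/2⌉ of 7, which then is at least k. All shares are integers for
  -- this reason.
  b²-divisible : 7 ℕ.^ k ∣ b ℕ.* b
  b²-divisible = ∣-trans (^-monoʳ-∣ 7 k≤2⌈k/2⌉) (divides (q ℕ.* q)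
    (≡.trans (regroup q (7 ℕ.^ ⌈ k /2⌉))
      (≡.cong (q ℕ.* q ℕ.*_) (≡.sym (ℕ.^-distribˡ-+-* 7 ⌈ k /2⌉ ⌈ k /2⌉)))))
    where
    q = quotient divisible
    k≤2⌈k/2⌉ : k ℕ.≤ ⌈ k /2⌉ ℕ.+ ⌈ k /2⌉
    k≤2⌈k/2⌉ = ℕ.≤-trans (ℕ.≤-reflexive (≡.sym (ℕ.⌊n/2⌋+⌈n/2⌉≡n k))) (ℕ.+-monoˡ-≤ ⌈ k /2⌉ (ℕ.⌊n/2⌋≤⌈n/2⌉ k))
    regroup : ∀ q x → q ℕ.* x ℕ.* (q ℕ.* x) ≡ q ℕ.* q ℕ.* (x ℕ.* x)
    regroup = ℕ-Solver.solve-∀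

  d : ℕ
  d = quotient b²-divisible

  b²≡ : b ℕ.* b ≡ 7 ℕ.^ k ℕ.* d
  b²≡ = ≡.trans (_∣_.equality b²-divisible) (ℕ.*-comm d (7 ℕ.^ k))

  L : ℝ
  L = fromℕ (7 ℕ.^ ℓ)

  0≤L : 0# ≤ L
  0≤L = 0≤fromℕ (7 ℕ.^ ℓ)

  2^k*b≢0 : NonZero (2 ℕ.^ k ℕ.* b)
  2^k*b≢0 = ℕ.m*n≢0⇒n≢0 (2 ℕ.^ ℓ) {{≡.subst NonZero n≡ n≢0}}

  instance
    b≢0 : NonZero b
    b≢0 = ℕ.m*n≢0⇒n≢0 (2 ℕ.^ k) {{2^k*b≢0}}

  -- θ = log₂ (n / (P^(1/ω) M^(1/2))), see λ₀≈2+θ.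
  β μ ν θ : ℝ
  β = log₂ (ι b)
  μ = log₂ (ι M)
  ν = μ * half
  θ = fromℕ ℓ + β - ν

  log-2^ : ∀ j → log₂ (ι (2 ℕ.^ j) {{ℕ.m^n≢0 2 j}}) ≈ fromℕ j
  log-2^ j = trans (log-ι-^ 2 j {{_}} {{ℕ.m^n≢0 2 j}}) (trans (*-congˡ log-2) (*-identityʳ _))

  log-n : log₂ (ι n) ≈ fromℕ ℓ + (fromℕ k + β)
  log-n = trans (log-ι-cong {{n≢0}} {{2^ℓ*2^k*b≢0}} n≡)
    (trans (log-ι-* (2 ℕ.^ ℓ) (2 ℕ.^ k ℕ.* b) {{ℕ.m^n≢0 2 ℓ}} {{2^k*b≢0}} {{2^ℓ*2^k*b≢0}})
      (+-cong (log-2^ ℓ) (trans (log-ι-* (2 ℕ.^ k) b {{ℕ.m^n≢0 2 k}} {{b≢0}} {{2^k*b≢0}}) (+-congʳ (log-2^ k)))))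
    where
    2^ℓ*2^k*b≢0 = ≡.subst NonZero n≡ n≢0

  log-P : log₂ (ι P) ≈ fromℕ k * ω
  log-P = trans (log-ι-cong {{P≢0}} {{ℕ.m^n≢0 7 k}} P≡7^k) (log-ι-^ 7 k {{_}} {{ℕ.m^n≢0 7 k}})

  L≈2^[ℓ*ω] : L ≈ 2^ (fromℕ ℓ * ω)
  L≈2^[ℓ*ω] = trans (sym (trans (2^log _) (ι≈fromℕ (7 ℕ.^ ℓ) {{ℕ.m^n≢0 7 ℓ}})))
    (2^-cong (log-ι-^ 7 ℓ {{_}} {{ℕ.m^n≢0 7 ℓ}}))

  ν+ν≈μ : ν + ν ≈ μ
  ν+ν≈μ = x*½+x*½≈x μ

  θ+ν≈ : θ + ν ≈ fromℕ ℓ + β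
  θ+ν≈ = x-y+y≈x _ ν

  λ₀ : ℝ
  λ₀ = log₂ ((ι 4 *⁺ ι n) /⁺ ((ι P ^ (1# ÷ ω₀)) *⁺ (ι M ^ (1# ÷ ι 2))))

  -- P^(1/ω) is 2^k, so its logarithm cancels the `k` in `log-n`; the 2 is the logarithm of the
  -- factor 4. Adding the logarithm of the denominator to both sides removes the quotient.
  λ₀≈2+θ : λ₀ ≈ fromℕ 2 + θ
  λ₀≈2+θ = +-cancelʳ (fromℕ k + ν) λ₀ (fromℕ 2 + θ)
    (trans (+-congˡ (sym log-denominator))
      (trans (log-/⁺ (ι 4 *⁺ ι n) _)
        (trans (log-* (ι 4) (ι n))
          (trans (+-cong (log-2^ 2) log-n)
            (sym (trans (solve 4 (λ a b c d → a :+ b :+ (c :+ d) := a :+ (b :+ d) :+ c) refl _ _ _ _)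
              (trans (+-congʳ (+-congˡ θ+ν≈))
                (solve 4 (λ a b c d → a :+ (b :+ d) :+ c := a :+ (b :+ (c :+ d))) refl _ _ _ _))))))))
    where
    open Solver
    log-denominator : log₂ ((ι P ^ (1# ÷ ω₀)) *⁺ (ι M ^ (1# ÷ ι 2))) ≈ fromℕ k + ν
    log-denominator = trans (log-* _ _) (+-cong
      (trans (log-^ (ι P) _) (trans (*-congʳ log-P) (trans (x÷y*y (fromℕ k) 1# ω₀) (*-identityʳ _))))
      (trans (log-^ (ι M) _) (*-congˡ (*-identityˡ half))))

  θ≤ℓ : θ ≤ fromℕ ℓ
  θ≤ℓ = ≤-trans (≤-trans (x≤y+x (0≤fromℕ 2)) (≤-reflexive (sym λ₀≈2+θ)))
        (≤-trans (proj₁ isCeiling) (go ⌈log⌉ ℓ≡max))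
    where
    go : ∀ z → + ℓ ≡ 0ℤ ℤ.⊔ z → fromℤ z ≤ fromℕ ℓ
    go (+ m)    ℓ≡ = ≤-reflexive (sym (fromℕ-cong (0⊔-injective ℓ≡)))
    go -[1+ m ] _  = ≤-trans (≤-trans (x≤x+y (0≤fromℕ (suc m))) (≤-reflexive (-‿inverseˡ _))) (0≤fromℕ ℓ)

  -- The ceiling exceeds `λ₀`, that is 2 + θ, by less than 1, whence the 3. The case distinction is
  -- on the sign of the integer `⌈log⌉`, so no real number is compared.
  ℓ≡0⊎ℓ≤θ+3 : ℓ ≡ 0 ⊎ fromℕ ℓ ≤ θ + fromℕ 3
  ℓ≡0⊎ℓ≤θ+3 = go ⌈log⌉ ℓ≡max (proj₂ isCeiling)
    where
    open Solver
    m≤ : ∀ m → fromℕ m - 1# < λ₀ → fromℕ m ≤ θ + fromℕ 3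
    m≤ m m-1<λ₀ = ≤-trans (≤-reflexive (sym (x-y+y≈x (fromℕ m) 1#)))
      (≤-trans (+-monoˡ-≤ 1# (<⇒≤ m-1<λ₀))
        (≤-reflexive (trans (+-congʳ λ₀≈2+θ)
          (solve 2 (λ a t → a :+ t :+ con 1 := t :+ (con 1 :+ a)) refl (fromℕ 2) θ))))
    go : ∀ z → + ℓ ≡ 0ℤ ℤ.⊔ z → fromℤ z - 1# < λ₀ → ℓ ≡ 0 ⊎ fromℕ ℓ ≤ θ + fromℕ 3
    go -[1+ m ] ℓ≡ _      = inj₁ (ℤ.+-injective ℓ≡)
    go (+ m)    ℓ≡ m-1<λ₀ = inj₂ (≤-trans (≤-reflexive (fromℕ-cong (0⊔-injective ℓ≡))) (m≤ m m-1<λ₀))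

-- The costs in terms of `ℓ`, `k` and `b`

module CostAsymptotics {c ℓ₁ ℓ₂ ℓ₃} (𝓡 : RealNumbers c ℓ₁ ℓ₂ ℓ₃)
  (cₛ : RealNumbers.ℝ 𝓡) (schedule : Schedule) where
  open RealNumbers 𝓡
  open CAPS 𝓡
  open OrderedFieldProperties orderedField
  open RealProperties 𝓡

  private module AP = AdmissibleProperties 𝓡

  N : ℝ
  N = fromℕ (messageCount schedule)

  0≤N : 0# ≤ N
  0≤N = 0≤fromℕ (messageCount schedule)

  -- `Θ` asks for positive constants; adding 1 makes positivity immediate from `0≤N`.
  1+N : ℝ⁺
  1+N = 1# + N , <-≤-trans 0<1 (x≤x+y 0≤N)

  N≤1+N : N ≤ 1# + N
  N≤1+N = x≤y+x (<⇒≤ 0<1)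

  module _ (π : Admissible) where
    open Admissible π
    open AP π
    open CostFormulas 𝓡 cₛ schedule k
    open CAPSPhases 𝓡 cₛ schedule k using (dfsCost; execution-bounds)
    open Costs cₛ schedule π
    open CAPS.Algorithm 𝓡 cₛ schedule k using (flops; words; messages)

    S X : ℕ
    S = shareSum k (2 ℕ.^ k ℕ.* b)
    X = dfsShareSum ℓ (2 ℕ.^ ℓ ℕ.* (2 ℕ.^ k ℕ.* b))

    cost-formula : ∀ {γ η φ y} → (∀ s → γ s ≈ y * fromℕ s) →
      dfsCost γ η φ ℓ n ≈ fromℕ 18 * (y * fromℕ X)
        + L * (φ b + (fromℕ 18 * (y * fromℕ S) + fromℕ 3 * levelSum η k (2 ℕ.^ k ℕ.* b)))
    cost-formula {γ} {η} {φ} γ≈ = trans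
      (reflexive (≡.cong (dfsCost γ η φ ℓ) n≡))
      (trans (dfsCost-formula γ≈ ℓ (2 ℕ.^ k ℕ.* b)) (+-congˡ (*-congˡ (bfsCost-formula γ≈ k b))))

    communication-formula : ∀ {η x q} → levelSum η k (2 ℕ.^ k ℕ.* b) ≈ x * q →
      dfsCost (λ _ → 0#) η (λ _ → 0#) ℓ n ≈ x * (L * (fromℕ 3 * q))
    communication-formula {η} {x} {q} sum≈ = trans (cost-formula λ s → sym (zeroˡ (fromℕ s)))
      (trans (+-congˡ (*-congˡ (+-congˡ (+-congˡ (*-congˡ sum≈)))))
        (solve 7 (λ a u l v t x q → a :* (con 0 :* u) :+ l :* (con 0 :+ (a :* (con 0 :* v) :+ t :* (x :* q)))
                             := x :* (l :* (t :* q)))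
          refl (fromℕ 18) (fromℕ X) L (fromℕ S) (fromℕ 3) x q))
      where open Solver

    flops-formula : ∀ {η} → (∀ s → η s ≈ 0#) →
      dfsCost fromℕ η (sequentialFlops cₛ) ℓ n
      ≈ L * sequentialFlops cₛ b + fromℕ 18 * (fromℕ X + L * fromℕ S)
    flops-formula η≈0 = trans (cost-formula λ s → sym (*-identityˡ (fromℕ s)))
      (trans (+-congˡ (*-congˡ (+-congˡ (+-congˡ (*-congˡ (trans (levelSum-constant η≈0 k _) (zeroˡ _)))))))
        (solve 6 (λ a u l f v t → a :* (con 1 :* u) :+ l :* (f :+ (a :* (con 1 :* v) :+ t :* con 0))
                             := l :* f :+ a :* (u :+ l :* v))
          refl (fromℕ 18) (fromℕ X) L (sequentialFlops cₛ b) (fromℕ S) (fromℕ 3)))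
      where open Solver

    3*S≤b² : fromℕ 3 * fromℕ S ≤ fromℕ (b ℕ.* b)
    3*S≤b² = ≤-trans (≤-reflexive (sym (fromℕ-* 3 S))) (fromℕ-mono-≤ (shareSum-≤ k b b²≡))

    b²≤7*S : fromℕ (b ℕ.* b) ≤ fromℕ 7 * fromℕ S
    b²≤7*S = ≤-trans (fromℕ-mono-≤ (shareSum-≥ k b 1≤k b²≡)) (≤-reflexive (fromℕ-* 7 S))

    -- 90 is 18 times 5, of which 4 comes from the DFS steps (`dfsShareSum-≤`) and 1 from the BFS
    -- steps.
    additions-≤ : fromℕ 18 * (fromℕ X + L * fromℕ S) ≤ fromℕ 90 * (L * fromℕ (b ℕ.* b))
    additions-≤ = ≤-trans (*-monoʳ-≤ (0≤fromℕ 18) inner)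
      (≤-reflexive (trans (sym (*-assoc (fromℕ 18) (fromℕ 5) _)) (*-congʳ (sym (fromℕ-* 18 5)))))
      where
      S≤b² : S ℕ.≤ b ℕ.* b
      S≤b² = ℕ.≤-trans (ℕ.m≤m+n S _) (shareSum-≤ k b b²≡)
      five : ∀ x → 4 ℕ.* x ℕ.+ x ≡ 5 ℕ.* x
      five = ℕ-Solver.solve-∀
      inner : fromℕ X + L * fromℕ S ≤ fromℕ 5 * (L * fromℕ (b ℕ.* b))
      inner = ≤-trans
        (≤-reflexive (sym (trans (fromℕ-+ X (7 ℕ.^ ℓ ℕ.* S)) (+-congˡ (fromℕ-* (7 ℕ.^ ℓ) S)))))
        (≤-trans
          (fromℕ-mono-≤ (ℕ.≤-trans
            (ℕ.+-mono-≤ (dfsShareSum-≤ ℓ b 1≤k b²≡) (ℕ.*-monoʳ-≤ (7 ℕ.^ ℓ) S≤b²))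
            (ℕ.≤-reflexive (five (7 ℕ.^ ℓ ℕ.* (b ℕ.* b))))))
          (≤-reflexive (trans (fromℕ-* 5 (7 ℕ.^ ℓ ℕ.* (b ℕ.* b))) (*-congˡ (fromℕ-* (7 ℕ.^ ℓ) (b ℕ.* b))))))

    words-bounds : L * (fromℕ 3 * fromℕ S) ≤ bandwidthCost
                 × bandwidthCost ≤ N * (L * (fromℕ 3 * fromℕ S))
    words-bounds =
      let lower , upper = execution-bounds words (λ _ → 0#) fromℕ (λ _ → 0#)
                            (λ _ a _ → sym (zeroʳ (fromℕ a))) (λ _ _ → refl) (λ _ _ _ → refl) 0≤fromℕ ℓ n
                            (≤-trans (*-nonNeg 0≤L (*-nonNeg (0≤fromℕ 3) (0≤fromℕ S))) (≤-reflexive (sym formula)))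
      in  ≤-trans (≤-reflexive (sym formula)) lower
        , ≤-trans upper (≤-reflexive (communication-formula (levelSum-linear (λ _ → refl) k _)))
      where
      formula : dfsCost (λ _ → 0#) fromℕ (λ _ → 0#) ℓ n ≈ L * (fromℕ 3 * fromℕ S)
      formula = trans (communication-formula (levelSum-linear (λ s → sym (*-identityˡ _)) k _)) (*-identityˡ _)

    messages-bounds : L * (fromℕ 3 * fromℕ k) ≤ latencyCost
                    × latencyCost ≤ N * (L * (fromℕ 3 * fromℕ k))
    messages-bounds =
      let lower , upper = execution-bounds messages (λ _ → 0#) (λ _ → 1#) (λ _ → 0#)
                            (λ _ a _ → sym (zeroʳ (fromℕ a))) (λ _ _ → refl) (λ _ _ _ → refl) (λ _ → <⇒≤ 0<1) ℓ n
                            (≤-trans (*-nonNeg 0≤L (*-nonNeg (0≤fromℕ 3) (0≤fromℕ k))) (≤-reflexive (sym formula)))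
      in  ≤-trans (≤-reflexive (sym formula)) lower
        , ≤-trans upper (≤-reflexive (communication-formula (levelSum-constant (λ _ → *-identityʳ N) k _)))
      where
      formula : dfsCost (λ _ → 0#) (λ _ → 1#) (λ _ → 0#) ℓ n ≈ L * (fromℕ 3 * fromℕ k)
      formula = trans (communication-formula (levelSum-constant (λ s → refl) k _)) (*-identityˡ _)

    -- The lower bound keeps only the local multiplications. Their count is a difference, so its
    -- sign has to be assumed here; `flops-Θ` derives it from the hypothesis on `cₛ`.
    flops-bounds : 0# ≤ sequentialFlops cₛ b → L * sequentialFlops cₛ b ≤ computationalCost
                 × computationalCost ≤ L * sequentialFlops cₛ b + fromℕ 90 * (L * fromℕ (b ℕ.* b))
    flops-bounds 0≤F =
      let lower , upper = execution-bounds flops fromℕ (λ _ → 0#) (sequentialFlops cₛ)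
                            (λ _ a s → fromℕ-* a s) (λ _ _ → refl) (λ _ _ _ → refl) (λ _ → ≤-refl) ℓ n
                            (≤-trans (*-nonNeg 0≤L 0≤F) L*F≤cost)
      in  ≤-trans L*F≤cost lower
        , ≤-trans upper (≤-trans (≤-reflexive (flops-formula (λ _ → zeroʳ N))) (+-monoʳ-≤ _ additions-≤))
      where
      L*F≤cost : L * sequentialFlops cₛ b ≤ dfsCost fromℕ (λ _ → 0#) (sequentialFlops cₛ) ℓ n
      L*F≤cost = ≤-trans
        (x≤x+y (*-nonNeg (0≤fromℕ 18) (+-nonNeg (0≤fromℕ X) (*-nonNeg 0≤L (0≤fromℕ S)))))
        (≤-reflexive (sym (flops-formula (λ _ → refl))))

    b^ω : ℝ
    b^ω = proj₁ (ι b ^ ω)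

    b^ω₀≈ : b ^ω₀ ≈ b^ω
    b^ω₀≈ = go b
      where
      go : ∀ m .{{_ : NonZero m}} → m ^ω₀ ≈ proj₁ (ι m ^ ω)
      go (suc m) = refl

    -- This absorbs the additions into the local multiplications; it holds as b is at least 1 and ω
    -- at least 2.
    b²≤b^ω : fromℕ (b ℕ.* b) ≤ b^ω
    b²≤b^ω = ≤-trans (≤-reflexive (trans (fromℕ-square b) (2^-cong (*-comm _ β))))
      (≤-trans (2^-mono-≤ (*-monoʳ-≤ (0≤log-ι b) 2≤ω)) (≤-reflexive (sym (^≈2^ (ι b) ω))))

  bandwidth-Θ : Θ (Costs.bandwidthCost cₛ schedule)
                  (λ π → let open AP π in L * fromℕ (b ℕ.* b))
  bandwidth-Θ = (ι 7 ⁻¹ , ⁻¹-pos (ι 7)) , 1+N , λ π →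
    let open AP π
        0≤b² = *-nonNeg (AP.0≤L π) (0≤fromℕ (b ℕ.* b))
    in ≤-trans (lower π) (proj₁ (words-bounds π))
     , ≤-trans (proj₂ (words-bounds π))
         (≤-trans (*-monoʳ-≤ 0≤N (*-monoʳ-≤ (AP.0≤L π) (3*S≤b² π))) (*-monoˡ-≤ 0≤b² N≤1+N))
    where
    open Solver
    lower : ∀ π → let open AP π in
            ι 7 ⁻¹ * (L * fromℕ (b ℕ.* b)) ≤ L * (fromℕ 3 * fromℕ (S π))
    lower π =
      ≤-trans (*-monoʳ-≤ (<⇒≤ (⁻¹-pos (ι 7))) (*-monoʳ-≤ (AP.0≤L π) (b²≤7*S π)))
        (≤-trans (≤-reflexive (trans
            (solve 4 (λ i l s v → i :* (l :* (s :* v)) := (s :* i) :* (l :* v)) refl (ι 7 ⁻¹) (AP.L π) (fromℕ 7) v)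
            (trans (*-congʳ (*-inverseʳ (ι 7))) (*-identityˡ _))))
          -- The 7 of `b²≤7*S` has cancelled against the constant 1/7; what remains is S ≤ 3 S.
          (*-monoʳ-≤ (AP.0≤L π) (≤-trans (x≤x+y (+-nonNeg (0≤fromℕ (S π)) (0≤fromℕ (S π))))
            (≤-reflexive (solve 1 (λ v → v :+ (v :+ v) := (con 1 :+ (con 1 :+ (con 1 :+ con 0))) :* v) refl v)))))
      where
      v = fromℕ (S π)

  latency-Θ : Θ (Costs.latencyCost cₛ schedule) (λ π → AP.L π * fromℕ (Admissible.k π))
  latency-Θ = ι 3 , 1+N *⁺ ι 3 , λ π →
    let open Admissible π
        assoc = solve 3 (λ t l k → t :* (l :* k) := l :* (t :* k)) refl (fromℕ 3) (AP.L π) (fromℕ k)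
        0≤k = *-nonNeg (AP.0≤L π) (*-nonNeg (0≤fromℕ 3) (0≤fromℕ k))
    in ≤-trans (≤-reflexive assoc) (proj₁ (messages-bounds π))
     , ≤-trans (proj₂ (messages-bounds π))
         (≤-trans (*-monoˡ-≤ 0≤k N≤1+N)
           (≤-reflexive (trans (*-congˡ (sym assoc)) (sym (*-assoc _ _ _)))))
    where open Solver

  flops-Θ : Θ (sequentialFlops cₛ) _^ω₀ → Θ (Costs.computationalCost cₛ schedule) (λ π → AP.L π * b^ω π)
  flops-Θ ((x , 0<x) , (y , 0<y) , F≍) =
    (x , 0<x) , (y + fromℕ 90 , <-≤-trans 0<y (x≤x+y (0≤fromℕ 90))) , λ π →
    let open AP π
        F≥ = ≤-trans (*-monoʳ-≤ (<⇒≤ 0<x) (≤-reflexive (sym (b^ω₀≈ π)))) (proj₁ (F≍ b))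
        F≤ = ≤-trans (proj₂ (F≍ b)) (*-monoʳ-≤ (<⇒≤ 0<y) (≤-reflexive (b^ω₀≈ π)))
        0≤F = ≤-trans (*-nonNeg (<⇒≤ 0<x) (<⇒≤ (proj₂ (ι b ^ ω)))) F≥
        lower , upper = flops-bounds π 0≤F
    in ≤-trans (≤-reflexive (solve 3 (λ x l p → x :* (l :* p) := l :* (x :* p)) refl x (AP.L π) (b^ω π)))
         (≤-trans (*-monoʳ-≤ (AP.0≤L π) F≥) lower)
     , ≤-trans upper
         (≤-trans (+-mono-≤ (*-monoʳ-≤ (AP.0≤L π) F≤)
                            (*-monoʳ-≤ (0≤fromℕ 90) (*-monoʳ-≤ (AP.0≤L π) (b²≤b^ω π))))
           (≤-reflexive (solve 4 (λ y l p q → l :* (y :* p) :+ q :* (l :* p) := (y :+ q) :* (l :* p))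
             refl y (AP.L π) (b^ω π) (fromℕ 90))))
    where open Solver

-- Comparison with the stated expressions

module TargetAsymptotics {c ℓ₁ ℓ₂ ℓ₃} (𝓡 : RealNumbers c ℓ₁ ℓ₂ ℓ₃) where
  open RealNumbers 𝓡
  open CAPS 𝓡
  open OrderedFieldProperties orderedField
  open RealProperties 𝓡
  open RingProperties (CommutativeRing.ring commutativeRing) using (+-cancelʳ)

  private module AP = AdmissibleProperties 𝓡

  2^-*-2^ : ∀ {x y z} → x + y ≈ z → 2^ x * 2^ y ≈ 2^ z
  2^-*-2^ x+y≈z = trans (sym (2^-+ _ _)) (2^-cong x+y≈z)

  module _ (π : Admissible) where
    open Admissible π
    open AP π

    module _ {ρ} (0≤ρ : 0# ≤ ρ) where

      2^ρθ⊔1≤2^ρℓ : 2^ (ρ * θ) ≤ 2^ (ρ * fromℕ ℓ) × 1# ≤ 2^ (ρ * fromℕ ℓ)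
      2^ρθ⊔1≤2^ρℓ = 2^-mono-≤ (*-monoʳ-≤ 0≤ρ θ≤ℓ) , 1≤2^ (*-nonNeg 0≤ρ (0≤fromℕ ℓ))

      -- An alternative instead of a maximum: each case bounds one argument of the `⊔` in `Θ-max`,
      -- which need not be known to be the larger one.
      2^ρℓ≤2^3ρ*[2^ρθ⊔1] : 2^ (ρ * fromℕ ℓ) ≤ 2^ (ρ * fromℕ 3)
                          ⊎ 2^ (ρ * fromℕ ℓ) ≤ 2^ (ρ * fromℕ 3) * 2^ (ρ * θ)
      2^ρℓ≤2^3ρ*[2^ρθ⊔1] with ℓ≡0⊎ℓ≤θ+3
      ... | inj₁ ℓ≡0   = inj₁ (2^-mono-≤ (*-monoʳ-≤ 0≤ρ
                           (≤-trans (≤-reflexive (fromℕ-cong ℓ≡0)) (0≤fromℕ 3))))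
      ... | inj₂ ℓ≤θ+3 = inj₂ (≤-trans (2^-mono-≤ (*-monoʳ-≤ 0≤ρ ℓ≤θ+3))
                           (≤-reflexive (sym (2^-*-2^ (trans (+-comm _ _) (sym (distribˡ ρ θ (fromℕ 3))))))))

  -- ℓ lies between max(θ, 0) and max(θ, 0) + 3.
  Θ-max : ∀ {ρ} {f A B y : Admissible → ℝ} → 0# ≤ ρ → (∀ π → 0# ≤ y π) →
    (∀ π → f π ≈ 2^ (ρ * fromℕ (Admissible.ℓ π)) * y π) →
    (∀ π → A π ≈ 2^ (ρ * AP.θ π) * y π) → (∀ π → B π ≈ y π) →
    Θ f (λ π → A π ⊔ B π)
  Θ-max {ρ} {f} {A} {B} {y} 0≤ρ 0≤y f≈ A≈ B≈ = (1# , 0<1) , ι 2 ^ (ρ * fromℕ 3) , λ π →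
    ≤-trans (≤-reflexive (*-identityˡ _)) (lower π) , upper π
    where
    0≤2^3ρ = <⇒≤ (0<2^ (ρ * fromℕ 3))
    lower : ∀ π → A π ⊔ B π ≤ f π
    lower π = ⊔-least
      (≤-trans (≤-reflexive (A≈ π))
        (≤-trans (*-monoˡ-≤ (0≤y π) (proj₁ (2^ρθ⊔1≤2^ρℓ π 0≤ρ))) (≤-reflexive (sym (f≈ π)))))
      (≤-trans (≤-reflexive (trans (B≈ π) (sym (*-identityˡ (y π)))))
        (≤-trans (*-monoˡ-≤ (0≤y π) (proj₂ (2^ρθ⊔1≤2^ρℓ π 0≤ρ))) (≤-reflexive (sym (f≈ π)))))
    upper : ∀ π → f π ≤ 2^ (ρ * fromℕ 3) * (A π ⊔ B π)
    upper π with 2^ρℓ≤2^3ρ*[2^ρθ⊔1] π 0≤ρ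
    ... | inj₁ ≤2^3ρ = ≤-trans (≤-reflexive (f≈ π))
      (≤-trans (*-monoˡ-≤ (0≤y π) ≤2^3ρ)
        (*-monoʳ-≤ 0≤2^3ρ (≤-trans (≤-reflexive (sym (B≈ π))) (y≤x⊔y (A π) (B π)))))
    ... | inj₂ ≤2^3ρθ = ≤-trans (≤-reflexive (f≈ π))
      (≤-trans (*-monoˡ-≤ (0≤y π) ≤2^3ρθ)
        (≤-trans (≤-reflexive (*-assoc _ _ (y π)))
          (*-monoʳ-≤ 0≤2^3ρ (≤-trans (≤-reflexive (sym (A≈ π))) (x≤x⊔y (A π) (B π))))))

  module _ (π : Admissible) where
    open Admissible π
    open AP π

    ℓ′ k′ : ℝ
    ℓ′ = fromℕ ℓ
    k′ = fromℕ k

    n^ω≈ : proj₁ (ι n ^ ω) ≈ 2^ ((ℓ′ + (k′ + β)) * ω)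
    n^ω≈ = trans (^≈2^ (ι n) ω) (2^-cong (*-congʳ log-n))

    P≈ : proj₁ (ι P) ≈ 2^ (k′ * ω)
    P≈ = trans (sym (2^log (ι P))) (2^-cong log-P)

    -- An exact equality, since n = 2^(ℓ+k) b and 2^ω = 7: the ω-th power of n is 7^ℓ P b^ω.
    computational-target : L * proj₁ (ι b ^ ω) ≈ proj₁ (ι n ^ ω) ÷ ι P
    computational-target = *≈⇒≈÷ (ι P)
      (trans (*-cong (trans (*-cong L≈2^[ℓ*ω] (^≈2^ (ι b) ω)) (2^-*-2^ refl)) P≈)
        (trans (2^-*-2^ (solve 4 (λ l k b w → l :* w :+ b :* w :+ k :* w := (l :+ (k :+ b)) :* w) refl ℓ′ k′ β ω))
          (sym n^ω≈)))
      where open Solver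

    -- The quantity 4^ℓ b², that is (n / 2^k)², which `bandwidth-target₂` identifies with n² /
    -- P^(2/ω).
    square : ℝ
    square = 2^ (fromℕ 2 * (ℓ′ + β))

    bandwidth-cost : L * fromℕ (b ℕ.* b) ≈ 2^ (δ * ℓ′) * square
    bandwidth-cost = trans (*-cong L≈2^[ℓ*ω] (fromℕ-square b))
      (trans (2^-*-2^ (trans (+-congʳ (*-congˡ (sym δ+2≈ω)))
        (solve 4 (λ l d t b → l :* (d :+ t) :+ t :* b := d :* l :+ t :* (l :+ b)) refl ℓ′ δ (fromℕ 2) β)))
        (2^-+ _ _))
      where open Solver

    bandwidth-target₁ : proj₁ (ι n ^ ω) ÷ (ι P *⁺ (ι M ^ (ω ÷ ι 2 - 1#))) ≈ 2^ (δ * θ) * square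
    bandwidth-target₁ = sym (*≈⇒≈÷ (ι P *⁺ (ι M ^ h))
      (trans (*-cong (sym (2^-+ _ _)) (trans (*-cong P≈ (^≈2^ (ι M) h)) (sym (2^-+ _ _))))
        (trans (2^-*-2^ exponents) (sym n^ω≈))))
      where
      open Solver
      h = ω ÷ ι 2 - 1#
      -- The exponent of M is δ/2. As `ν` is half of log M, the power of M is 2^(νδ), and it
      -- completes 2^(δθ) to 2^(δ(ℓ+β)) by `θ+ν≈`.
      2h≈δ : h + h ≈ δ
      2h≈δ = +-cancelʳ (fromℕ 2) (h + h) δ
        (trans (solve 1 (λ h → h :+ h :+ (con 1 :+ (con 1 :+ con 0)) := (h :+ con 1) :+ (h :+ con 1)) refl h)
          (trans (+-cong (x-y+y≈x (ω ÷ ι 2) 1#) (x-y+y≈x (ω ÷ ι 2) 1#)) (trans (x*½+x*½≈x ω) (sym δ+2≈ω))))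
      μh≈νδ : μ * h ≈ ν * δ
      μh≈νδ = trans (*-congʳ (sym ν+ν≈μ))
        (trans (solve 2 (λ v h → (v :+ v) :* h := v :* (h :+ h)) refl ν h) (*-congˡ 2h≈δ))
      exponents : δ * θ + fromℕ 2 * (ℓ′ + β) + (k′ * ω + μ * h) ≈ (ℓ′ + (k′ + β)) * ω
      exponents = trans (+-congˡ (+-congˡ μh≈νδ))
        (trans (solve 6 (λ d t v s q x → d :* t :+ q :* s :+ (x :+ v :* d) := (d :* (t :+ v) :+ q :* s) :+ x)
                  refl δ θ ν (ℓ′ + β) (fromℕ 2) (k′ * ω))
        (trans (+-congʳ (+-congʳ (*-congˡ θ+ν≈)))
        (trans (+-congʳ (sym (distribʳ (ℓ′ + β) δ (fromℕ 2))))
        (trans (+-congʳ (*-congʳ δ+2≈ω))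
          (solve 4 (λ l b k w → w :* (l :+ b) :+ k :* w := (l :+ (k :+ b)) :* w) refl ℓ′ β k′ ω)))))

    bandwidth-target₂ : fromℕ (n ℕ.* n) ÷ (ι P ^ (fromℕ 2 ÷ ω₀)) ≈ square
    bandwidth-target₂ = sym (*≈⇒≈÷ (ι P ^ (fromℕ 2 ÷ ω₀))
      (trans (*-congˡ (trans (^≈2^ (ι P) _) (2^-cong (trans (*-congʳ log-P) (x÷y*y k′ (fromℕ 2) ω₀)))))
        (trans (2^-*-2^ (solve 4 (λ q l b k → q :* (l :+ b) :+ k :* q := q :* (l :+ (k :+ b))) refl (fromℕ 2) ℓ′ β k′))
          (sym (trans (fromℕ-square n) (2^-cong (*-congˡ log-n)))))))
      where open Solver

    latency-cost : L * log₂ (ι P) ≈ 2^ (ω * ℓ′) * log₂ (ι P)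
    latency-cost = *-congʳ (trans L≈2^[ℓ*ω] (2^-cong (*-comm ℓ′ ω)))

    latency-target : proj₁ (ι n ^ ω) ÷ (ι P *⁺ (ι M ^ (ω ÷ ι 2))) * log₂ (ι P) ≈ 2^ (ω * θ) * log₂ (ι P)
    latency-target = *-congʳ (sym (*≈⇒≈÷ (ι P *⁺ (ι M ^ (ω ÷ ι 2)))
      (trans (*-congˡ (trans (*-cong P≈ (^≈2^ (ι M) (ω ÷ ι 2))) (sym (2^-+ _ _))))
        (trans (2^-*-2^ (trans
            (solve 5 (λ w t x m i → w :* t :+ (x :+ m :* (w :* i)) := w :* (t :+ m :* i) :+ x) refl ω θ (k′ * ω) μ half)
            (trans (+-congʳ (*-congˡ θ+ν≈))
              (solve 4 (λ l b k w → w :* (l :+ b) :+ k :* w := (l :+ (k :+ b)) :* w) refl ℓ′ β k′ ω))))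
          (sym n^ω≈)))))
      where open Solver

    k≈ : k′ ≈ ω₀ ⁻¹ * log₂ (ι P)
    k≈ = trans (sym (*-÷-cancel k′ ω₀)) (trans (*-comm _ _) (*-congˡ (sym log-P)))

  0≤ω : 0# ≤ ω
  0≤ω = <⇒≤ (proj₂ ω₀)

  bandwidth-target-Θ : Θ {I = Admissible}
    (λ π → AP.L π * fromℕ (AP.b π ℕ.* AP.b π))
    (λ π → let open Admissible π in
      (proj₁ (ι n ^ ω) ÷ (ι P *⁺ (ι M ^ (ω ÷ ι 2 - 1#)))) ⊔ (fromℕ (n ℕ.* n) ÷ (ι P ^ (fromℕ 2 ÷ ω₀))))
  -- The exponent is `δ` because a DFS step multiplies the words by 7/4 at fixed `square`; for the
  -- latency it is `ω`, because the number of messages is multiplied by 7.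
  bandwidth-target-Θ = Θ-max 0≤δ (λ π → <⇒≤ (0<2^ _)) bandwidth-cost bandwidth-target₁ bandwidth-target₂

  latency-target-Θ : Θ {I = Admissible} (λ π → AP.L π * fromℕ (Admissible.k π))
    (λ π → let open Admissible π in
      ((proj₁ (ι n ^ ω) ÷ (ι P *⁺ (ι M ^ (ω ÷ ι 2)))) * log₂ (ι P)) ⊔ log₂ (ι P))
  latency-target-Θ = Θ-trans
    (Θ-scaled (ω₀ ⁻¹ , ⁻¹-pos ω₀) λ π → trans (*-congˡ (k≈ π))
      (trans (sym (*-assoc _ _ _)) (trans (*-congʳ (*-comm _ _)) (*-assoc _ _ _))))
    (Θ-max 0≤ω (λ π → 0≤log-ι (Admissible.P π)) latency-cost latency-target (λ _ → refl))

theorem3p1 : {c ℓ₁ ℓ₂ ℓ₃ : Level} (𝓡 : RealNumbers c ℓ₁ ℓ₂ ℓ₃) →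
    let open RealNumbers 𝓡
        open CAPS 𝓡
        ω = proj₁ ω₀
    in (cₛ : ℝ) → Θ (sequentialFlops cₛ) _^ω₀ →
       (schedule : Schedule) →
       let open Costs cₛ schedule in
       Θ {I = Admissible} computationalCost
         (λ π → let open Admissible π in
           proj₁ (ι n ^ ω) ÷ ι P)
       ×
       Θ {I = Admissible} bandwidthCost
         (λ π → let open Admissible π in
           (proj₁ (ι n ^ ω) ÷ (ι P *⁺ (ι M ^ (ω ÷ ι 2 - 1#))))
           ⊔ (fromℕ (n ℕ.* n) ÷ (ι P ^ (fromℕ 2 ÷ ω₀))))
       ×
       Θ {I = Admissible} latencyCost
         (λ π → let open Admissible π in
           ((proj₁ (ι n ^ ω) ÷ (ι P *⁺ (ι M ^ (ω ÷ ι 2)))) * log₂ (ι P))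
           ⊔ log₂ (ι P))
theorem3p1 𝓡 cₛ F≍ schedule =
    Θ-trans (flops-Θ F≍) (Θ-≈ computational-target)
  , Θ-trans bandwidth-Θ bandwidth-target-Θ
  , Θ-trans latency-Θ latency-target-Θ
  where
  open RealNumbers 𝓡
  open OrderedFieldProperties orderedField
  open CostAsymptotics 𝓡 cₛ schedule
  open TargetAsymptotics 𝓡
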